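{- For every $n\ge1$ and every lattice congruence $R$ of the weak order on $S_n$, every vertex of the quotient graph $Q_R$ has degree at most $2n-\lceil 2\sqrt n\,\rceil$. Moreover, for every $n\ge1$ there is a lattice congruence $R$ of the weak order on $S_n$ such that $Q_R$ has a vertex of degree exactly $2n-\lceil2\sqrt n\,\rceil$.
   Context: $S_n$ is the set of permutations of $[n]$ with the weak order: $\pi\le\rho$ iff $\mathrm{inv}(\pi)\subseteq\mathrm{inv}(\rho)$, where $\mathrm{inv}(a_1\cdots a_n)=\{(a_i,a_j):i<j,\ a_i>a_j\}$. A lattice congruence is an equivalence relation compatible with joins and meets. The quotient graph $Q_R$ is the undirected cover graph of the lattice quotient $S_n/R$, whose elements are the classes, ordered by $X<Y$ iff $x<y$ for some $x\in X$, $y\in Y$. -}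

module Defs where

open import Data.Fin.Base as Fin using (Fin)
open import Data.Fin.Permutation using (Permutation′; _⟨$⟩ʳ_; _≈_)
open import Data.List.Base using (List; length)
open import Data.List.Relation.Unary.All using (All)
import Data.List.Membership.Setoid as Membership
import Data.List.Relation.Unary.Unique.Setoid as UniqueSetoid
open import Data.Nat.Base using (ℕ; zero; suc; _+_; _*_; _≤_; _<_; _≥_; z≤n; s≤s)
open import Data.Nat.Properties
open import Data.Product.Base using (_×_; _,_; ∃; ∃₂; proj₁; proj₂)
open import Data.Sum.Base using (_⊎_)
open import Function.Base using (flip)
open import Function.Bundles using (_⇔_)
open import Level using (0ℓ)
open import Relation.Binary.Bundles using (Setoid)
open import Relation.Binary.Core using (Rel; _⇒_)
import Relation.Binary.Construct.NonStrictToStrict as ToStrict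
open import Relation.Binary.PropositionalEquality using (_≡_; subst)
open import Relation.Binary.Structures using (IsEquivalence)
open import Relation.Nullary using (¬_; yes; no)
open import Relation.Unary using (Pred; _⊆_)

-- The one-line notation a₁⋯aₙ of π is a_i = π ⟨$⟩ʳ i, with positions and
-- values numbered from 0.  Permutations are compared by the pointwise
-- equality _≈_ of Data.Fin.Permutation.

inv : ∀ {n} → Permutation′ n → Pred (Fin n × Fin n) 0ℓ
inv π p = ∃₂ λ i j →
  i Fin.< j × (π ⟨$⟩ʳ i) Fin.> (π ⟨$⟩ʳ j) × p ≡ (π ⟨$⟩ʳ i , π ⟨$⟩ʳ j)

infix 4 _≤ʷ_ _<ʷ_

_≤ʷ_ : ∀ {n} → Rel (Permutation′ n) 0ℓ
π ≤ʷ ρ = inv π ⊆ inv ρ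

_<ʷ_ : ∀ {n} → Rel (Permutation′ n) 0ℓ
_<ʷ_ = ToStrict._<_ _≈_ _≤ʷ_

IsJoin : ∀ {A : Set} → Rel A 0ℓ → A → A → A → Set
IsJoin _≼_ x y j = x ≼ j × y ≼ j × (∀ z → x ≼ z → y ≼ z → j ≼ z)

IsMeet : ∀ {A : Set} → Rel A 0ℓ → A → A → A → Set
IsMeet _≼_ = IsJoin (flip _≼_)

-- The weak order is a lattice, so that joins and meets exist and are unique
-- up to _≈_; they are referred to here through their universal property
-- instead of through chosen operations.

record LatticeCongruence (n : ℕ) : Set₁ where
  infix 4 _∼_
  field
    _∼_           : Rel (Permutation′ n) 0ℓ
    isEquivalence : IsEquivalence _∼_
    ≈⇒∼           : _≈_ ⇒ _∼_
    ∨-cong        : ∀ {x x′ y y′ j j′} → x ∼ x′ → y ∼ y′ →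
                    IsJoin _≤ʷ_ x y j → IsJoin _≤ʷ_ x′ y′ j′ → j ∼ j′
    ∧-cong        : ∀ {x x′ y y′ m m′} → x ∼ x′ → y ∼ y′ →
                    IsMeet _≤ʷ_ x y m → IsMeet _≤ʷ_ x′ y′ m′ → m ∼ m′

-- A class of R is given by any of its members: the elements of S_n/R are the
-- permutations, with R as their equality.

module Quotient {n : ℕ} (R : LatticeCongruence n) where
  open LatticeCongruence R

  classes : Setoid 0ℓ 0ℓ
  classes = record { isEquivalence = isEquivalence }

  open Membership classes using (_∈_)
  open UniqueSetoid classes using (Unique)

  infix 4 _⊏_ _⋖_

  -- The order on classes is strict, so a comparison x < y inside a single
  -- class does not count; hence the first component.

  _⊏_ : Rel (Permutation′ n) 0ℓ
  X ⊏ Y = ¬ (X ∼ Y) × ∃₂ λ x y → x ∼ X × y ∼ Y × x <ʷ y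

  _⋖_ : Rel (Permutation′ n) 0ℓ
  X ⋖ Y = X ⊏ Y × ¬ (∃ λ Z → X ⊏ Z × Z ⊏ Y)

  Adjacent : Rel (Permutation′ n) 0ℓ
  Adjacent X Y = X ⋖ Y ⊎ Y ⋖ X

  -- _∼_ need not be decidable, so the neighbours of X cannot always be listed.
  -- An upper bound on the degree is therefore a bound on the length of every
  -- list of pairwise distinct neighbours.

  DegreeAtMost : Permutation′ n → ℕ → Set
  DegreeAtMost X d = ∀ Ys → Unique Ys → All (Adjacent X) Ys → length Ys ≤ d

  HasDegree : Permutation′ n → ℕ → Set
  HasDegree X d = ∃ λ Ys → Unique Ys × (∀ Y → Adjacent X Y ⇔ Y ∈ Ys) × length Ys ≡ d

open Quotient public using (DegreeAtMost; HasDegree)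

⌈√_⌉ : ℕ → ℕ
⌈√ zero ⌉  = 0
⌈√ suc m ⌉ with suc m ≤? ⌈√ m ⌉ * ⌈√ m ⌉
... | yes _ = ⌈√ m ⌉
... | no  _ = suc ⌈√ m ⌉

-- 2√n = √(4n)

⌈2√_⌉ : ℕ → ℕ
⌈2√ n ⌉ = ⌈√ 4 * n ⌉

-- ⌈√ m ⌉ is the least r with √m ≤ r, that is, with m ≤ r * r.

⌈√⌉-upper : ∀ m → m ≤ ⌈√ m ⌉ * ⌈√ m ⌉
⌈√⌉-upper zero = z≤n
⌈√⌉-upper (suc m) with suc m ≤? ⌈√ m ⌉ * ⌈√ m ⌉
... | yes p = p
... | no  _ = s≤s (≤-trans (⌈√⌉-upper m)
                (≤-trans (*-monoʳ-≤ ⌈√ m ⌉ (n≤1+n ⌈√ m ⌉)) (m≤n+m _ ⌈√ m ⌉)))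

⌈√⌉-least : ∀ m k → m ≤ k * k → ⌈√ m ⌉ ≤ k
⌈√⌉-least zero    k _ = z≤n
⌈√⌉-least (suc m) k p with suc m ≤? ⌈√ m ⌉ * ⌈√ m ⌉
... | yes _ = ⌈√⌉-least m k (≤-trans (n≤1+n m) p)
... | no ¬q = ≰⇒> λ k≤r → ¬q (≤-trans p (*-mono-≤ k≤r k≤r))

-- The subtraction in 2n − ⌈2√n⌉ is never truncated for n ≥ 1.

⌈2√n⌉≤2n : ∀ n → n ≥ 1 → ⌈2√ n ⌉ ≤ 2 * n
⌈2√n⌉≤2n n n≥1 = ⌈√⌉-least (4 * n) (2 * n) (begin
  4 * n             ≡⟨ *-assoc 2 2 n ⟩
  2 * (2 * n)       ≤⟨ *-monoˡ-≤ (2 * n) (*-monoʳ-≤ 2 n≥1) ⟩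
  (2 * n) * (2 * n) ∎)
  where open ≤-Reasoning

{-# OPTIONS --safe #-}

-- Let ρ be the minimum and π the maximum of a class X.  The classes covered by
-- X correspond to descents of ρ and those covering X to ascents of π, that is,
-- to descents of the reversal σ of π.  As inv ρ ⊆ inv π, no pair is inverted in
-- both ρ and σ, so a descending run of ρ and one of σ share at most one value.
-- Hence n ≤ a b if there are a and b such runs, the degree is at most
-- (n − a) + (n − b), and (a + b)² ≥ 4 a b ≥ 4 n.
--
-- For equality let a + b = ⌈2√n⌉ with a and b as equal as possible, and let ρ
-- and σ list the values v by increasing v / b and by increasing v % b, in
-- decreasing order where these agree.  Contracting exactly the arcs of length
-- greater than b puts ρ and π in one class, and identifies neither of them with
-- a neighbour across a descent of ρ or of σ, as these have length at most b.

module Submission where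

open import Defs
open import Data.Empty using (⊥)
open import Data.Fin.Base as Fin using (Fin; zero; suc; toℕ; fromℕ<; combine; join; opposite)
import Data.Fin.Induction as Fin
import Data.Fin.Properties as Fin
import Data.Fin.Permutation.Components as Components
open import Data.Fin.Permutation
  using (Permutation′; permutation; transpose; reverse; _∘ₚ_; _⟨$⟩ʳ_; _⟨$⟩ˡ_; _≈_; inverseˡ; inverseʳ)
open import Data.Fin.Subset using (Subset; ∁; _∈_; _∉_)
import Data.Fin.Subset.Properties as Subset
open import Data.List.Base
  using (List; []; _∷_; _++_; length; filter; map; lookup; allFin; cartesianProduct)
import Data.List.Membership.Propositional as List
open import Data.List.Membership.Propositional.Properties
  using (∈-filter⁺; ∈-lookup; ∈-allFin; ∈-cartesianProduct⁺)
open import Data.List.Membership.Setoid.Properties using (index-injective)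
open import Data.List.Properties
  using (filter-notAll; length-tabulate; length-map; length-++)
open import Data.List.Relation.Unary.All as All using (All; []; _∷_)
import Data.List.Relation.Unary.All.Properties as All
open import Data.List.Relation.Unary.AllPairs as AllPairs using (AllPairs; []; _∷_)
import Data.List.Relation.Unary.AllPairs.Properties as AllPairs
open import Data.List.Relation.Unary.Any as Any using (here; there; index)
open import Data.List.Relation.Unary.Unique.Propositional.Properties using (allFin⁺; filter⁺)
open import Data.Nat.Base
  using (ℕ; zero; suc; _+_; _*_; _∸_; _≤_; _<_; _≥_; z≤n; s≤s; NonZero; ≢-nonZero; >-nonZero⁻¹; ⌊_/2⌋; ⌈_/2⌉)
open import Data.Nat.DivMod
  using (_/_; _%_; m≡m%n+[m/n]*n; m%n<n; [m+n]%n≡m%n; /-monoˡ-≤; m<n*o⇒m/o<n)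
import Data.Nat.Induction as ℕ
open import Data.Nat.Properties
open import Data.Nat.Tactic.RingSolver using (solve-∀)
open import Data.Product.Base using (_×_; _,_; ∃; ∃₂; proj₁; proj₂; Σ-syntax)
open import Data.Sum.Base using (_⊎_; inj₁; inj₂; [_,_]′)
open import Data.Sum.Properties using (inj₁-injective; inj₂-injective)
open import Data.Vec.Base using (tabulate)
open import Data.Vec.Properties using (lookup∘tabulate; lookup⇒[]=; []=⇒lookup)
open import Function.Base using (id; _∘_; _on_; flip)
open import Function.Bundles using (mk⇔)
open import Function.Definitions using (Injective)
open import Induction.WellFounded using (WellFounded; Acc; acc; module Subrelation)
open import Level using (0ℓ)
open import Relation.Binary.Core using (Rel)
open import Relation.Binary.Construct.Closure.Transitive using (TransClosure; [_]; _∷_)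
  renaming (_++_ to _++⁺_)
import Relation.Binary.Construct.On as On
open import Relation.Binary.Definitions
  using (Tri; tri<; tri≈; tri>; Transitive; Trichotomous)
import Relation.Binary.Definitions as Binary
open import Relation.Binary.PropositionalEquality
  using (_≡_; _≢_; refl; sym; trans; cong; cong₂; subst; subst₂; setoid)
open import Relation.Binary.Structures using (IsEquivalence)
open import Relation.Nullary
  using (¬_; Dec; yes; no; contradiction; does; ¬?; _×-dec_; _→-dec_; _⊎-dec_; map′)
open import Relation.Nullary.Decidable using (decidable-stable; dec-true; dec-false)
open import Relation.Unary using (Pred; Decidable)

private
  variable
    n : ℕ
    p q u v w : Fin n
    x y z j m : Permutation′ n

-- The order in which a permutation lists the values

infix 4 _≺[_]_ _≼_

-- A record, so that `u`, `x` and `v` can be inferred from a proof.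
record _≺[_]_ (u : Fin n) (x : Permutation′ n) (v : Fin n) : Set where
  constructor before
  field positions : x ⟨$⟩ˡ u Fin.< x ⟨$⟩ˡ v

≺-trans : u ≺[ x ] v → v ≺[ x ] w → u ≺[ x ] w
≺-trans (before i<j) (before j<k) = before (Fin.<-trans i<j j<k)

≺-asym : u ≺[ x ] v → ¬ v ≺[ x ] u
≺-asym (before i<j) (before j<i) = Fin.<-asym i<j j<i

≺-irrefl : ¬ u ≺[ x ] u
≺-irrefl u≺u = ≺-asym u≺u u≺u

position-injective : ∀ (x : Permutation′ n) → x ⟨$⟩ˡ u ≡ x ⟨$⟩ˡ v → u ≡ v
position-injective x eq = trans (sym (inverseʳ x)) (trans (cong (x ⟨$⟩ʳ_) eq) (inverseʳ x))

≺-cmp : ∀ (x : Permutation′ n) → Trichotomous _≡_ _≺[ x ]_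
≺-cmp x u v with Fin.<-cmp (x ⟨$⟩ˡ u) (x ⟨$⟩ˡ v)
... | tri< i<j i≢j j≮i = tri< (before i<j) (λ { refl → i≢j refl }) (λ { (before j<i) → j≮i j<i })
... | tri≈ i≮j i≡j j≮i =
  tri≈ (λ { (before i<j) → i≮j i<j }) (position-injective x i≡j) (λ { (before j<i) → j≮i j<i })
... | tri> i≮j i≢j j<i = tri> (λ { (before i<j) → i≮j i<j }) (λ { refl → i≢j refl }) (before j<i)

≺? : ∀ (x : Permutation′ n) → Binary.Decidable _≺[ x ]_
≺? x u v = map′ before _≺[_]_.positions (x ⟨$⟩ˡ u Fin.<? x ⟨$⟩ˡ v)

⊀⇒≻ : u ≢ v → ¬ u ≺[ x ] v → v ≺[ x ] u
⊀⇒≻ {u = u} {v} {x} u≢v u⊀v with ≺-cmp x u v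
... | tri< u≺v _ _ = contradiction u≺v u⊀v
... | tri≈ _ u≡v _ = contradiction u≡v u≢v
... | tri> _ _ v≺u = v≺u

≺-wellFounded : ∀ (x : Permutation′ n) → WellFounded _≺[ x ]_
≺-wellFounded x = Subrelation.wellFounded _≺[_]_.positions
  (On.wellFounded (x ⟨$⟩ˡ_) Fin.<-wellFounded)

≻-wellFounded : ∀ (x : Permutation′ n) → WellFounded (flip _≺[ x ]_)
≻-wellFounded x = Subrelation.wellFounded _≺[_]_.positions
  (On.wellFounded (x ⟨$⟩ˡ_) Fin.>-wellFounded)

-- The weak order, by `≤ʷ⇒≼` and `≼⇒≤ʷ`, in a form that speaks of values only.
_≼_ : Rel (Permutation′ n) 0ℓ
x ≼ y = ∀ {p q} → q Fin.< p → p ≺[ x ] q → p ≺[ y ] q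

≤ʷ⇒≼ : x ≤ʷ y → x ≼ y
≤ʷ⇒≼ {x = x} {y} x≤y {p} {q} q<p (before i<j)
  with x≤y (x ⟨$⟩ˡ p , x ⟨$⟩ˡ q , i<j ,
            subst₂ Fin._<_ (sym (inverseʳ x)) (sym (inverseʳ x)) q<p ,
            cong₂ _,_ (sym (inverseʳ x)) (sym (inverseʳ x)))
... | k , l , k<l , _ , refl =
  before (subst₂ Fin._<_ (sym (inverseˡ y)) (sym (inverseˡ y)) k<l)

≼⇒≤ʷ : x ≼ y → x ≤ʷ y
≼⇒≤ʷ {x = x} {y} x≼y (i , j , i<j , xj<xi , refl)
  with x≼y xj<xi (before (subst₂ Fin._<_ (sym (inverseˡ x)) (sym (inverseˡ x)) i<j))
... | before k<l =
  y ⟨$⟩ˡ (x ⟨$⟩ʳ i) , y ⟨$⟩ˡ (x ⟨$⟩ʳ j) , k<l ,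
  subst₂ Fin._<_ (sym (inverseʳ y)) (sym (inverseʳ y)) xj<xi ,
  cong₂ _,_ (sym (inverseʳ y)) (sym (inverseʳ y))

≼-refl : x ≼ x
≼-refl _ = id

≼-trans : x ≼ y → y ≼ z → x ≼ z
≼-trans x≼y y≼z q<p = y≼z q<p ∘ x≼y q<p

-- Otherwise `i`, `f i`, `f (f i)`, ... would be an infinite descent.
increasing⇒≮ : (f : Fin n → Fin n) → (∀ {i j} → i Fin.< j → f i Fin.< f j) → ∀ i → ¬ f i Fin.< i
increasing⇒≮ f f-mono i = go i (Fin.<-wellFounded i)
  where
  go : ∀ i → Acc Fin._<_ i → ¬ f i Fin.< i
  go i (acc rs) fi<i = go (f i) (rs fi<i) (f-mono fi<i)

≼∧≽⇒≺ : x ≼ y → y ≼ x → u ≺[ x ] v → u ≺[ y ] v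
≼∧≽⇒≺ {u = u} {v} x≼y y≼x u≺v with Fin.<-cmp u v
... | tri< u<v u≢v _ = ⊀⇒≻ (u≢v ∘ sym) (≺-asym u≺v ∘ y≼x u<v)
... | tri≈ _ refl _ = contradiction u≺v ≺-irrefl
... | tri> _ _ v<u = x≼y v<u u≺v

transition-mono : x ≼ y → y ≼ x → ∀ {i k} → i Fin.< k →
  y ⟨$⟩ˡ (x ⟨$⟩ʳ i) Fin.< y ⟨$⟩ˡ (x ⟨$⟩ʳ k)
transition-mono {x = x} {y} x≼y y≼x i<k = _≺[_]_.positions (≼∧≽⇒≺ x≼y y≼x
  (before (subst₂ Fin._<_ (sym (inverseˡ x)) (sym (inverseˡ x)) i<k)))

-- The map from positions in `x` to positions in `y` of the same value is increasing, and so is its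
-- inverse. Neither moves a position down, so both are the identity.
≼-antisym : x ≼ y → y ≼ x → x ≈ y
≼-antisym {x = x} {y} x≼y y≼x i with Fin.<-cmp (y ⟨$⟩ˡ (x ⟨$⟩ʳ i)) i
... | tri≈ _ eq _ = trans (sym (inverseʳ y)) (cong (y ⟨$⟩ʳ_) eq)
... | tri< lt _ _ = contradiction lt (increasing⇒≮ _ (transition-mono x≼y y≼x) i)
... | tri> _ _ gt = contradiction
  (subst (Fin._< y ⟨$⟩ˡ (x ⟨$⟩ʳ i)) (sym (trans (cong (x ⟨$⟩ˡ_) (inverseʳ y)) (inverseˡ x))) gt)
  (increasing⇒≮ _ (transition-mono y≼x x≼y) (y ⟨$⟩ˡ (x ⟨$⟩ʳ i)))

-- Reversal of the one-line notation

opposite-anti : {i j : Fin n} → i Fin.< j → opposite j Fin.< opposite i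
opposite-anti {i = i} {j} i<j = subst₂ _<_ (sym (Fin.opposite-prop j)) (sym (Fin.opposite-prop i))
  (∸-monoʳ-< (s≤s i<j) (Fin.toℕ<n j))

-- Abstract, so that unification does not unfold rev into the fields of a bijection.

abstract

  rev : Permutation′ n → Permutation′ n
  rev x = reverse ∘ₚ x

  rev⁺ : u ≺[ x ] v → v ≺[ rev x ] u
  rev⁺ (before i<j) = before (opposite-anti i<j)

  rev-cong : x ≈ y → rev x ≈ rev y
  rev-cong x≈y i = x≈y (opposite i)

  rev-involutive : ∀ (x : Permutation′ n) → rev (rev x) ≈ x
  rev-involutive x i = cong (x ⟨$⟩ʳ_) (Fin.opposite-involutive i)

rev⁻ : u ≺[ rev x ] v → v ≺[ x ] u
rev⁻ {u = u} {x} {v} u≺v with ≺-cmp x u v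
... | tri< u≺v′ _ _ = contradiction u≺v (≺-asym (rev⁺ u≺v′))
... | tri≈ _ refl _ = contradiction u≺v ≺-irrefl
... | tri> _ _ v≺u = v≺u

rev-≈⁻ : rev x ≈ rev y → x ≈ y
rev-≈⁻ {x = x} {y} rx≈ry i =
  trans (sym (rev-involutive x i)) (trans (rev-cong rx≈ry i) (rev-involutive y i))

-- Both sides say that no pair is inverted in `x` and in `y`.
≼-rev : x ≼ rev y → y ≼ rev x
≼-rev x≼ry q<p p≺q =
  rev⁺ (⊀⇒≻ (Fin.<⇒≢ q<p ∘ sym) λ p≺q′ → ≺-asym p≺q (rev⁻ (x≼ry q<p p≺q′)))

rev-rev-≼ : rev (rev x) ≼ x
rev-rev-≼ _ = rev⁻ ∘ rev⁻

≼-rev-rev : x ≼ rev (rev x)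
≼-rev-rev _ = rev⁺ ∘ rev⁺

rev-anti : x ≼ y → rev y ≼ rev x
rev-anti x≼y = ≼-rev (≼-trans x≼y ≼-rev-rev)

rev-≼ : rev x ≼ y → rev y ≼ x
rev-≼ rx≼y = ≼-trans (rev-anti rx≼y) rev-rev-≼

isJoin-rev : IsJoin _≼_ x y j → IsMeet _≼_ (rev x) (rev y) (rev j)
isJoin-rev (x≼j , y≼j , least) =
  rev-anti x≼j , rev-anti y≼j , λ z z≼x z≼y → ≼-rev (least (rev z) (≼-rev z≼x) (≼-rev z≼y))

isMeet-rev : IsMeet _≼_ x y m → IsJoin _≼_ (rev x) (rev y) (rev m)
isMeet-rev (m≼x , m≼y , greatest) =
  rev-anti m≼x , rev-anti m≼y , λ z x≼z y≼z → rev-≼ (greatest (rev z) (rev-≼ x≼z) (rev-≼ y≼z))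

isJoin-≤ʷ⇒≼ : IsJoin _≤ʷ_ x y j → IsJoin _≼_ x y j
isJoin-≤ʷ⇒≼ {x = x} {y} {j} (x≤j , y≤j , least) =
  ≤ʷ⇒≼ x≤j , ≤ʷ⇒≼ y≤j , λ z x≼z y≼z → ≤ʷ⇒≼ (least z (≼⇒≤ʷ {x = x} {z} x≼z) (≼⇒≤ʷ {x = y} {z} y≼z))

isJoin-≼⇒≤ʷ : IsJoin _≼_ x y j → IsJoin _≤ʷ_ x y j
isJoin-≼⇒≤ʷ {x = x} {y} {j} (x≼j , y≼j , least) =
  ≼⇒≤ʷ {x = x} {j} x≼j , ≼⇒≤ʷ {x = y} {j} y≼j ,
  λ z x≤z y≤z → ≼⇒≤ʷ {x = j} {z} (least z (≤ʷ⇒≼ x≤z) (≤ʷ⇒≼ y≤z))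

isMeet-≤ʷ⇒≼ : IsMeet _≤ʷ_ x y m → IsMeet _≼_ x y m
isMeet-≤ʷ⇒≼ {x = x} {y} {m} (m≤x , m≤y , greatest) =
  ≤ʷ⇒≼ m≤x , ≤ʷ⇒≼ m≤y , λ z z≼x z≼y → ≤ʷ⇒≼ (greatest z (≼⇒≤ʷ {x = z} {x} z≼x) (≼⇒≤ʷ {x = z} {y} z≼y))

isMeet-≼⇒≤ʷ : IsMeet _≼_ x y m → IsMeet _≤ʷ_ x y m
isMeet-≼⇒≤ʷ {x = x} {y} {m} (m≼x , m≼y , greatest) =
  ≼⇒≤ʷ {x = m} {x} m≼x , ≼⇒≤ʷ {x = m} {y} m≼y ,
  λ z z≤x z≤y → ≼⇒≤ʷ {x = z} {m} (greatest z (≤ʷ⇒≼ z≤x) (≤ʷ⇒≼ z≤y))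

-- Permutations from total orders, meets and joins

-- A missed value `k` would extend `f` to an injection from `Fin (suc n)` to `Fin n`.
injective⇒surjective : (f : Fin n → Fin n) → Injective _≡_ _≡_ f → ∀ k → ∃ λ i → f i ≡ k
injective⇒surjective {n} f f-inj k with Fin.any? (λ i → f i Fin.≟ k)
... | yes preimage = preimage
... | no  missed   = contradiction (Fin.injective⇒≤ g-inj) 1+n≰n
  where
  g : Fin (suc n) → Fin n
  g zero    = k
  g (suc i) = f i
  g-inj : Injective _≡_ _≡_ g
  g-inj {zero}  {zero}  _  = refl
  g-inj {zero}  {suc i} eq = contradiction (i , sym eq) missed
  g-inj {suc i} {zero}  eq = contradiction (i , eq) missed
  g-inj {suc i} {suc k} eq = cong suc (f-inj eq)

module _ {a ℓ ℓ′} {A : Set a} {P : Pred A ℓ} {Q : Pred A ℓ′} (P? : Decidable P) (Q? : Decidable Q)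
         (P⊆Q : ∀ {a} → P a → Q a) where

  length-filter-mono : ∀ xs → length (filter P? xs) ≤ length (filter Q? xs)
  length-filter-mono [] = z≤n
  length-filter-mono (x ∷ xs) with P? x | Q? x
  ... | yes _  | yes _  = s≤s (length-filter-mono xs)
  ... | yes px | no ¬qx = contradiction (P⊆Q px) ¬qx
  ... | no _   | yes _  = m≤n⇒m≤1+n (length-filter-mono xs)
  ... | no _   | no _   = length-filter-mono xs

  length-filter-mono-< : ∀ {x xs} → x List.∈ xs → ¬ P x → Q x →
    length (filter P? xs) < length (filter Q? xs)
  length-filter-mono-< {xs = x ∷ xs} (here refl) ¬px qx with P? x | Q? x
  ... | yes px | _      = contradiction px ¬px
  ... | no _   | no ¬qx = contradiction qx ¬qx
  ... | no _   | yes _  = s≤s (length-filter-mono xs)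
  length-filter-mono-< {xs = x ∷ xs} (there x∈xs) ¬px qx
    with ih ← length-filter-mono-< x∈xs ¬px qx | P? x | Q? x
  ... | yes _  | yes _  = s≤s ih
  ... | yes px | no ¬qx = contradiction (P⊆Q px) ¬qx
  ... | no _   | yes _  = m≤n⇒m≤1+n ih
  ... | no _   | no _   = ih

-- The position of a value is the number of its predecessors. This count is strictly monotone, so it
-- is injective and thereby a bijection.
module FromOrder {_⊲_ : Rel (Fin n) 0ℓ} (⊲-trans : Transitive _⊲_) (⊲-cmp : Trichotomous _≡_ _⊲_) where

  private
    ⊲-irrefl : ¬ u ⊲ u
    ⊲-irrefl {u} u⊲u with ⊲-cmp u u
    ... | tri< _ u≢u _   = u≢u refl
    ... | tri≈ u⋪u _ _   = u⋪u u⊲u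
    ... | tri> _ u≢u _   = u≢u refl

    ⊲? : ∀ v → Decidable (_⊲ v)
    ⊲? v u with ⊲-cmp u v
    ... | tri< u⊲v _ _ = yes u⊲v
    ... | tri≈ u⋪v _ _ = no u⋪v
    ... | tri> u⋪v _ _ = no u⋪v

    rank : Fin n → ℕ
    rank v = length (filter (⊲? v) (allFin n))

    rank<n : ∀ v → rank v < n
    rank<n v = subst (rank v <_) (length-tabulate id)
      (filter-notAll (⊲? v) (allFin n) (Any.map (λ { refl → ⊲-irrefl }) (∈-allFin v)))

    rank-mono : u ⊲ v → rank u < rank v
    rank-mono {u} {v} u⊲v =
      length-filter-mono-< (⊲? u) (⊲? v) (λ w⊲u → ⊲-trans w⊲u u⊲v) (∈-allFin u) ⊲-irrefl u⊲v

    position : Fin n → Fin n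
    position v = fromℕ< (rank<n v)

    position-mono : u ⊲ v → position u Fin.< position v
    position-mono {u} {v} u⊲v = subst₂ _<_ (sym (Fin.toℕ-fromℕ< (rank<n u)))
      (sym (Fin.toℕ-fromℕ< (rank<n v))) (rank-mono u⊲v)

    position-inj : Injective _≡_ _≡_ position
    position-inj {u} {v} eq with ⊲-cmp u v
    ... | tri< u⊲v _ _ = contradiction (position-mono u⊲v) (Fin.<-irrefl eq)
    ... | tri≈ _ u≡v _ = u≡v
    ... | tri> _ _ v⊲u = contradiction (position-mono v⊲u) (Fin.<-irrefl (sym eq))

    at : ∀ i → ∃ λ v → position v ≡ i
    at = injective⇒surjective position position-inj

  abstract

    perm : Permutation′ n
    perm = permutation (proj₁ ∘ at) position
      (λ v → position-inj (proj₂ (at (position v)))) (λ i → proj₂ (at i))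

    ⊲⇒≺ : u ⊲ v → u ≺[ perm ] v
    ⊲⇒≺ u⊲v = before (position-mono u⊲v)

  ≺⇒⊲ : u ≺[ perm ] v → u ⊲ v
  ≺⇒⊲ {u} {v} u≺v with ⊲-cmp u v
  ... | tri< u⊲v _ _  = u⊲v
  ... | tri≈ _ refl _ = contradiction u≺v ≺-irrefl
  ... | tri> _ _ v⊲u  = contradiction u≺v (≺-asym (⊲⇒≺ v⊲u))

module Meet (x y : Permutation′ n) where

  Step : Rel (Fin n) 0ℓ
  Step u v = u Fin.< v × (u ≺[ x ] v ⊎ u ≺[ y ] v)

  -- The pairs kept in increasing order by the meet of x and y are the
  -- transitive closure of those kept in increasing order by x or by y.

  Ascent : Rel (Fin n) 0ℓ
  Ascent = TransClosure Step

  ascent⇒< : Ascent u v → u Fin.< v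
  ascent⇒< [ u<v , _ ]      = u<v
  ascent⇒< ((u<v , _) ∷ vs) = Fin.<-trans u<v (ascent⇒< vs)

  private
    step? : Binary.Decidable Step
    step? u v with u Fin.<? v | ≺? x u v | ≺? y u v
    ... | no u≮v  | _       | _       = no (u≮v ∘ proj₁)
    ... | yes u<v | yes u≺v | _       = yes (u<v , inj₁ u≺v)
    ... | yes u<v | no _    | yes u≺v = yes (u<v , inj₂ u≺v)
    ... | yes u<v | no u⊀v  | no u⊀′v = no ([ u⊀v , u⊀′v ]′ ∘ proj₂)

    ascent? : Binary.Decidable Ascent
    ascent? u v = go u (Fin.>-wellFounded u)
      where
      go : ∀ u → Acc Fin._>_ u → Dec (Ascent u v)
      go u (acc rs) with step? u v | Fin.any? via?
        where
        via? : ∀ w → Dec (Step u w × Ascent w v)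
        via? w with step? u w
        ... | no ¬s = no (¬s ∘ proj₁)
        ... | yes s = map′ (s ,_) proj₂ (go w (rs (proj₁ s)))
      ... | yes s | _                = yes [ s ]
      ... | no _  | yes (_ , s , ss) = yes (s ∷ ss)
      ... | no ¬s | no ¬via          = no λ { [ s ] → ¬s s ; (s ∷ ss) → ¬via (_ , s , ss) }

    step-split : Step u v → u Fin.< w → w Fin.< v → Step u w ⊎ Step w v
    step-split (u<v , inj₁ u≺v) u<w w<v with ≺-cmp x _ _
    ... | tri< u≺w _ _  = inj₁ (u<w , inj₁ u≺w)
    ... | tri≈ _ refl _ = contradiction refl (Fin.<⇒≢ u<w)
    ... | tri> _ _ w≺u  = inj₂ (w<v , inj₁ (≺-trans w≺u u≺v))
    step-split (u<v , inj₂ u≺v) u<w w<v with ≺-cmp y _ _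
    ... | tri< u≺w _ _  = inj₁ (u<w , inj₂ u≺w)
    ... | tri≈ _ refl _ = contradiction refl (Fin.<⇒≢ u<w)
    ... | tri> _ _ w≺u  = inj₂ (w<v , inj₂ (≺-trans w≺u u≺v))

    -- This makes the pairs that are not ascents transitive as well, so that keeping the ascents and
    -- inverting all other pairs gives a total order.
    ascent-split : Ascent u v → u Fin.< w → w Fin.< v → Ascent u w ⊎ Ascent w v
    ascent-split [ s ] u<w w<v = [ inj₁ ∘ [_] , inj₂ ∘ [_] ]′ (step-split s u<w w<v)
    ascent-split {w = w} (_∷_ {y = t} s ss) u<w w<v with Fin.<-cmp w t
    ... | tri< w<t _ _  = [ inj₁ ∘ [_] , inj₂ ∘ (_∷ ss) ]′ (step-split s u<w w<t)
    ... | tri≈ _ refl _ = inj₁ [ s ]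
    ... | tri> _ _ t<w  = [ inj₁ ∘ (s ∷_) , inj₂ ]′ (ascent-split ss t<w w<v)

    _⊲_ : Rel (Fin n) 0ℓ
    u ⊲ v = Ascent u v ⊎ (v Fin.< u × ¬ Ascent v u)

    ⊲-trans : Transitive _⊲_
    ⊲-trans (inj₁ uv) (inj₁ vw) = inj₁ (uv ++⁺ vw)
    ⊲-trans {u} {v} {w} (inj₁ uv) (inj₂ (w<v , ¬wv)) with Fin.<-cmp u w
    ... | tri< u<w _ _  = [ inj₁ , (λ wv → contradiction wv ¬wv) ]′ (ascent-split uv u<w w<v)
    ... | tri≈ _ refl _ = contradiction uv ¬wv
    ... | tri> _ _ w<u  = inj₂ (w<u , λ wu → ¬wv (wu ++⁺ uv))
    ⊲-trans {u} {v} {w} (inj₂ (v<u , ¬vu)) (inj₁ vw) with Fin.<-cmp u w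
    ... | tri< u<w _ _  = [ (λ vu → contradiction vu ¬vu) , inj₁ ]′ (ascent-split vw v<u u<w)
    ... | tri≈ _ refl _ = contradiction vw ¬vu
    ... | tri> _ _ w<u  = inj₂ (w<u , λ wu → ¬vu (vw ++⁺ wu))
    ⊲-trans (inj₂ (v<u , ¬vu)) (inj₂ (w<v , ¬wv)) =
      inj₂ (Fin.<-trans w<v v<u , λ wu → [ ¬wv , ¬vu ]′ (ascent-split wu w<v v<u))

    ⊲-asym : u ⊲ v → ¬ v ⊲ u
    ⊲-asym (inj₁ uv)         (inj₁ vu)         = Fin.<-asym (ascent⇒< uv) (ascent⇒< vu)
    ⊲-asym (inj₁ uv)         (inj₂ (_ , ¬uv))  = ¬uv uv
    ⊲-asym (inj₂ (_ , ¬vu))  (inj₁ vu)         = ¬vu vu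
    ⊲-asym (inj₂ (v<u , _))  (inj₂ (u<v , _))  = Fin.<-asym u<v v<u

    ⊲⇒≢ : u ⊲ v → u ≢ v
    ⊲⇒≢ u⊲u refl = ⊲-asym u⊲u u⊲u

    ⊲-total : u Fin.< v → u ⊲ v ⊎ v ⊲ u
    ⊲-total {u} {v} u<v with ascent? u v
    ... | yes uv = inj₁ (inj₁ uv)
    ... | no ¬uv = inj₂ (inj₂ (u<v , ¬uv))

    tri⁺ : u ⊲ v ⊎ v ⊲ u → Tri (u ⊲ v) (u ≡ v) (v ⊲ u)
    tri⁺ (inj₁ u⊲v) = tri< u⊲v (⊲⇒≢ u⊲v) (⊲-asym u⊲v)
    tri⁺ (inj₂ v⊲u) = tri> (⊲-asym v⊲u) (⊲⇒≢ v⊲u ∘ sym) v⊲u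

    ⊲-cmp : Trichotomous _≡_ _⊲_
    ⊲-cmp u v with Fin.<-cmp u v
    ... | tri< u<v _ _  = tri⁺ (⊲-total u<v)
    ... | tri≈ _ refl _ = tri≈ (λ u⊲u → ⊲⇒≢ u⊲u refl) refl (λ u⊲u → ⊲⇒≢ u⊲u refl)
    ... | tri> _ _ v<u  = tri⁺ ([ inj₂ , inj₁ ]′ (⊲-total v<u))

    module Order = FromOrder ⊲-trans ⊲-cmp

  meet : Permutation′ n
  meet = Order.perm

  inverted⇒¬ascent : p ≺[ meet ] q → ¬ Ascent q p
  inverted⇒¬ascent p≺q qp = ≺-asym p≺q (Order.⊲⇒≺ (inj₁ qp))

  ¬ascent⇒inverted : q Fin.< p → ¬ Ascent q p → p ≺[ meet ] q
  ¬ascent⇒inverted q<p ¬qp = Order.⊲⇒≺ (inj₂ (q<p , ¬qp))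

  -- A common lower bound `z` keeps every step in increasing order, hence every ascent by
  -- transitivity. So its inversions are inverted in `meet`.
  isMeet : IsMeet _≼_ x y meet
  isMeet =
    (λ q<p p≺q → ⊀⇒≻ (Fin.<⇒≢ q<p) λ q≺p → inverted⇒¬ascent p≺q [ q<p , inj₁ q≺p ]) ,
    (λ q<p p≺q → ⊀⇒≻ (Fin.<⇒≢ q<p) λ q≺p → inverted⇒¬ascent p≺q [ q<p , inj₂ q≺p ]) ,
    λ z z≼x z≼y q<p p≺q → ¬ascent⇒inverted q<p λ qp → ≺-asym p≺q (ascent⇒≺ z z≼x z≼y qp)
    where
    step⇒≺ : ∀ z → z ≼ x → z ≼ y → Step u v → u ≺[ z ] v
    step⇒≺ z z≼x z≼y (u<v , inj₁ u≺v) =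
      ⊀⇒≻ (Fin.<⇒≢ u<v ∘ sym) λ v≺u → ≺-asym u≺v (z≼x u<v v≺u)
    step⇒≺ z z≼x z≼y (u<v , inj₂ u≺v) =
      ⊀⇒≻ (Fin.<⇒≢ u<v ∘ sym) λ v≺u → ≺-asym u≺v (z≼y u<v v≺u)

    ascent⇒≺ : ∀ z → z ≼ x → z ≼ y → Ascent u v → u ≺[ z ] v
    ascent⇒≺ z z≼x z≼y [ s ]    = step⇒≺ z z≼x z≼y s
    ascent⇒≺ z z≼x z≼y (s ∷ ss) = ≺-trans (step⇒≺ z z≼x z≼y s) (ascent⇒≺ z z≼x z≼y ss)

open Meet using (meet)

isMeet : ∀ (x y : Permutation′ n) → IsMeet _≼_ x y (meet x y)
isMeet = Meet.isMeet

joinʷ : Permutation′ n → Permutation′ n → Permutation′ n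
joinʷ x y = rev (meet (rev x) (rev y))

isJoin : ∀ (x y : Permutation′ n) → IsJoin _≼_ x y (joinʷ x y)
isJoin x y with isMeet (rev x) (rev y)
... | m≼rx , m≼ry , greatest =
  ≼-rev m≼rx , ≼-rev m≼ry , λ z x≼z y≼z → rev-≼ (greatest (rev z) (rev-anti x≼z) (rev-anti y≼z))

isMeet-≼ : x ≼ y → IsMeet _≼_ x y x
isMeet-≼ x≼y = ≼-refl , x≼y , λ _ z≼x _ → z≼x

isMeet-≽ : y ≼ x → IsMeet _≼_ x y y
isMeet-≽ y≼x = y≼x , ≼-refl , λ _ _ z≼y → z≼y

isJoin-≼ : x ≼ y → IsJoin _≼_ x y y
isJoin-≼ x≼y = x≼y , ≼-refl , λ _ _ y≼z → y≼z

isJoin-≽ : y ≼ x → IsJoin _≼_ x y x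
isJoin-≽ y≼x = ≼-refl , y≼x , λ _ x≼z _ → x≼z

-- Descents

Consecutive : Permutation′ n → Fin n → Fin n → Set
Consecutive x p q = p ≺[ x ] q × (∀ w → ¬ (p ≺[ x ] w × w ≺[ x ] q))

Descent : Permutation′ n → Fin n → Fin n → Set
Descent x p q = q Fin.< p × Consecutive x p q

descent? : ∀ (x : Permutation′ n) → Binary.Decidable (Descent x)
descent? x p q =
  (q Fin.<? p) ×-dec ≺? x p q ×-dec Fin.all? (λ w → ¬? (≺? x p w ×-dec ≺? x w q))

successor : ∀ (x : Permutation′ n) → p ≺[ x ] v → ∃ λ q → Consecutive x p q × (q ≡ v ⊎ q ≺[ x ] v)
successor {n} {p} {v} x = go v (≺-wellFounded x v)
  where
  go : ∀ v → Acc _≺[ x ]_ v → p ≺[ x ] v → ∃ λ q → Consecutive x p q × (q ≡ v ⊎ q ≺[ x ] v)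
  go v (acc rs) p≺v with Fin.any? (λ w → ≺? x p w ×-dec ≺? x w v)
  ... | no none = v , (p≺v , λ w between → none (w , between)) , inj₁ refl
  ... | yes (w , p≺w , w≺v) with go w (rs w≺v) p≺w
  ...   | q , consecutive , inj₁ refl = q , consecutive , inj₂ w≺v
  ...   | q , consecutive , inj₂ q≺w  = q , consecutive , inj₂ (≺-trans q≺w w≺v)

consecutive-unique : Consecutive x p u → Consecutive x p v → u ≡ v
consecutive-unique {x = x} {p} {u} {v} (p≺u , u-first) (p≺v , v-first) with ≺-cmp x u v
... | tri< u≺v _ _ = contradiction (p≺u , u≺v) (v-first u)
... | tri≈ _ u≡v _ = u≡v
... | tri> _ _ v≺u = contradiction (p≺v , v≺u) (u-first v)

-- If `y` inverts every descent of `x`, it keeps the order of all consecutive values of `x`, the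
-- ascents because `y ≼ x`. Chaining them gives `x ≼ y`.
descent-below : ∀ (x y : Permutation′ n) → y ≼ x →
  x ≼ y ⊎ ∃₂ λ p q → Descent x p q × ¬ p ≺[ y ] q
descent-below x y y≼x
  with Fin.any? (λ p → Fin.any? (λ q → descent? x p q ×-dec ¬? (≺? y p q)))
... | yes found = inj₂ found
... | no none   = inj₁ λ {p} _ → go p (≻-wellFounded x p)
  where
  consecutive⇒≺ : Consecutive x p q → p ≺[ y ] q
  consecutive⇒≺ {p} {q} c@(p≺q , _) with Fin.<-cmp p q
  ... | tri< p<q p≢q _ = ⊀⇒≻ (p≢q ∘ sym) (≺-asym p≺q ∘ y≼x p<q)
  ... | tri≈ _ refl _  = contradiction p≺q ≺-irrefl
  ... | tri> _ _ q<p   = decidable-stable (≺? y p q) λ p⊀q → none (p , q , (q<p , c) , p⊀q)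

  go : ∀ p → Acc (flip _≺[ x ]_) p → p ≺[ x ] v → p ≺[ y ] v
  go p (acc rs) p≺v with successor x p≺v
  ... | q , c , inj₁ refl = consecutive⇒≺ c
  ... | q , c , inj₂ q≺v  = ≺-trans (consecutive⇒≺ c) (go q (rs (proj₁ c)) q≺v)

-- As `_∘ₚ_` applies `x` first, the values `p` and `q` are swapped, not the positions. At a descent
-- this is an element covered by `x` in the weak order.
lower : Permutation′ n → Fin n → Fin n → Permutation′ n
lower x p q = x ∘ₚ transpose p q

module _ (p q : Fin n) where

  transpose-first : Components.transpose p q p ≡ q
  transpose-first rewrite dec-true (p Fin.≟ p) refl = refl

  transpose-second : Components.transpose p q q ≡ p
  transpose-second with q Fin.≟ p
  ... | yes q≡p = q≡p
  ... | no _ rewrite dec-true (q Fin.≟ q) refl = refl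

  transpose-other : u ≢ p → u ≢ q → Components.transpose p q u ≡ u
  transpose-other {u} u≢p u≢q
    rewrite dec-false (u Fin.≟ p) u≢p | dec-false (u Fin.≟ q) u≢q = refl

module _ {x : Permutation′ n} where

  private
    -- The inverse of `transpose p q` is given by `Components.transpose q p`, hence the order of the
    -- arguments.
    via : ∀ {u′ v′} → Components.transpose q p u ≡ u′ → Components.transpose q p v ≡ v′ →
      u′ ≺[ x ] v′ → u ≺[ lower x p q ] v
    via refl refl (before i<j) = before i<j

  lower-swapped : p ≺[ x ] q → q ≺[ lower x p q ] p
  lower-swapped {p} {q} = via (transpose-first q p) (transpose-second q p)

  -- Since nothing lies between `p` and `q`, any other value is on the same side of both.
  lower-kept : Consecutive x p q → u ≺[ x ] v → ¬ (u ≡ p × v ≡ q) → u ≺[ lower x p q ] v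
  lower-kept {p} {q} {u} {v} (p≺q , none) u≺v not-pq
    with u Fin.≟ p | u Fin.≟ q | v Fin.≟ p | v Fin.≟ q
  ... | yes refl | _        | yes refl | _        = contradiction u≺v ≺-irrefl
  ... | yes refl | _        | _        | yes refl = contradiction (refl , refl) not-pq
  ... | yes refl | _        | no v≢p   | no v≢q   =
    via (transpose-second q p) (transpose-other q p v≢q v≢p) (⊀⇒≻ v≢q λ v≺q → none v (u≺v , v≺q))
  ... | no _     | yes refl | yes refl | _        = contradiction u≺v (≺-asym p≺q)
  ... | no _     | yes refl | _        | yes refl = contradiction u≺v ≺-irrefl
  ... | no _     | yes refl | no v≢p   | no v≢q   =
    via (transpose-first q p) (transpose-other q p v≢q v≢p) (≺-trans p≺q u≺v)
  ... | no u≢p   | no u≢q   | yes refl | _        =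
    via (transpose-other q p u≢q u≢p) (transpose-second q p) (≺-trans u≺v p≺q)
  ... | no u≢p   | no u≢q   | no _     | yes refl =
    via (transpose-other q p u≢q u≢p) (transpose-first q p)
      (⊀⇒≻ (u≢p ∘ sym) λ p≺u → none u (p≺u , u≺v))
  ... | no u≢p   | no u≢q   | no v≢p   | no v≢q   =
    via (transpose-other q p u≢q u≢p) (transpose-other q p v≢q v≢p) u≺v

  lower-≼ : Descent x p q → lower x p q ≼ x
  lower-≼ {p} {q} (q<p , c) {u} {v} v<u u≺v = ⊀⇒≻ (Fin.<⇒≢ v<u) λ v≺u →
    ≺-asym u≺v (lower-kept c v≺u λ { (refl , refl) → Fin.<-asym v<u q<p })

  -- Swapping removes the inversion of `p` and `q` and no other. With `lower-≼-inverted`, anything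
  -- between `lower x p q` and `x` equals one of them, depending on whether it inverts `p` and `q`.
  ≼-lower : Descent x p q → y ≼ x → ¬ p ≺[ y ] q → y ≼ lower x p q
  ≼-lower (_ , c) y≼x p⊀q v<u u≺v = lower-kept c (y≼x v<u u≺v) λ { (refl , refl) → p⊀q u≺v }

  lower-≼-inverted : Descent x p q → lower x p q ≼ y → p ≺[ y ] q → x ≼ y
  lower-≼-inverted {p} {q} (_ , c) lower≼y p≺q {u} {v} v<u u≺v with u Fin.≟ p | v Fin.≟ q
  ... | yes refl | yes refl = p≺q
  ... | no u≢p   | _        = lower≼y v<u (lower-kept c u≺v (u≢p ∘ proj₁))
  ... | yes refl | no v≢q   = lower≼y v<u (lower-kept c u≺v (v≢q ∘ proj₂))

  lower-⋡ : Descent x p q → ¬ x ≼ lower x p q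
  lower-⋡ (q<p , p≺q , _) x≼lower = ≺-asym (x≼lower q<p p≺q) (lower-swapped p≺q)

  -- Each of the two lacks a single inversion of `x`, and the other one has it.
  isJoin-lower : ∀ {p′ q′} → Descent x p q → Descent x p′ q′ → p ≢ p′ →
    IsJoin _≼_ (lower x p q) (lower x p′ q′) x
  isJoin-lower {p} {q} {p′} {q′} d d′ p≢p′ = lower-≼ d , lower-≼ d′ , least
    where
    least : ∀ z → lower x p q ≼ z → lower x p′ q′ ≼ z → x ≼ z
    least z c≼z c′≼z {u} v<u u≺v with u Fin.≟ p
    ... | yes refl = c′≼z v<u (lower-kept (proj₂ d′) u≺v (p≢p′ ∘ proj₁))
    ... | no u≢p   = c≼z v<u (lower-kept (proj₂ d) u≺v (u≢p ∘ proj₁))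

-- Descending runs

Top : Permutation′ n → Pred (Fin n) 0ℓ
Top x p = ∃ (Descent x p)

top? : ∀ (x : Permutation′ n) → Decidable (Top x)
top? x p = Fin.any? (descent? x p)

-- Off the descent tops the value of next is junk.

next : Permutation′ n → Fin n → Fin n
next x p with top? x p
... | yes (q , _) = q
... | no _        = p

top⇒descent : ∀ (x : Permutation′ n) → Top x p → Descent x p (next x p)
top⇒descent {p = p} x top with top? x p
... | yes (_ , d) = d
... | no ¬top     = contradiction top ¬top

next-unique : Descent x p q → next x p ≡ q
next-unique {x = x} d = consecutive-unique (proj₂ (top⇒descent x (_ , d))) (proj₂ d)

tops ends : Permutation′ n → List (Fin n)
tops x = filter (top? x) (allFin _)
ends x = filter (¬? ∘ top? x) (allFin _)

length-filter-∁ : ∀ {a ℓ} {A : Set a} {P : Pred A ℓ} (P? : Decidable P) xs →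
  length (filter P? xs) + length (filter (¬? ∘ P?) xs) ≡ length xs
length-filter-∁ P? [] = refl
length-filter-∁ P? (x ∷ xs) with P? x
... | yes _ = cong suc (length-filter-∁ P? xs)
... | no _  = trans (+-suc _ _) (cong suc (length-filter-∁ P? xs))

tops+ends≡n : ∀ (x : Permutation′ n) → length (tops x) + length (ends x) ≡ n
tops+ends≡n x = trans (length-filter-∁ (top? x) (allFin _)) (length-tabulate id)

index-injective-≡ : ∀ {a} {A : Set a} {xs : List A} {x y} (x∈xs : x List.∈ xs) (y∈xs : y List.∈ xs) →
  index x∈xs ≡ index y∈xs → x ≡ y
index-injective-≡ {A = A} = index-injective (setoid A)

∈-tops : ∀ (x : Permutation′ n) → Top x v → v List.∈ tops x
∈-tops x = ∈-filter⁺ (top? x) (∈-allFin _)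

∈-ends : ∀ (x : Permutation′ n) → ¬ Top x v → v List.∈ ends x
∈-ends x = ∈-filter⁺ (¬? ∘ top? x) (∈-allFin _)

-- The last condition says that v and e lie in the same descending run, in a
-- form that determines which of two values with the same e comes first.

RunEnd : Permutation′ n → Fin n → Fin n → Set
RunEnd x v e = ¬ Top x e × (v ≡ e ⊎ v ≺[ x ] e) ×
  (∀ w → v ≺[ x ] w → w ≡ e ⊎ w ≺[ x ] e → w Fin.< v)

runEnd : ∀ (x : Permutation′ n) v → ∃ (RunEnd x v)
runEnd x v = go v (Fin.<-wellFounded v)
  where
  go : ∀ v → Acc Fin._<_ v → ∃ (RunEnd x v)
  go v (acc rs) with top? x v
  ... | no ¬top = v , ¬top , inj₁ refl , λ where
    w v≺w (inj₁ refl) → contradiction v≺w ≺-irrefl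
    w v≺w (inj₂ w≺v)  → contradiction v≺w (≺-asym w≺v)
  ... | yes (q , q<v , v≺q , none) with go q (rs q<v)
  ...   | e , ¬top , q≼e , descending = e , ¬top , inj₂ (v≺e q≼e) , below
    where
    v≺e : q ≡ e ⊎ q ≺[ x ] e → v ≺[ x ] e
    v≺e (inj₁ refl) = v≺q
    v≺e (inj₂ q≺e)  = ≺-trans v≺q q≺e

    below : ∀ w → v ≺[ x ] w → w ≡ e ⊎ w ≺[ x ] e → w Fin.< v
    below w v≺w w≼e with ≺-cmp x w q
    ... | tri< w≺q _ _  = contradiction (v≺w , w≺q) (none w)
    ... | tri≈ _ refl _ = q<v
    ... | tri> _ _ q≺w  = Fin.<-trans (descending w q≺w w≼e) q<v

-- If `u` came first, its run would descend to `e` through `v`, giving `v < u`.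
runEnd-inverted : ∀ {e} → RunEnd x u e → RunEnd x v e → u Fin.< v → v ≺[ x ] u
runEnd-inverted {v = v} (_ , _ , below) (_ , v≼e , _) u<v =
  ⊀⇒≻ (Fin.<⇒≢ u<v) λ u≺v → Fin.<-asym u<v (below v u≺v v≼e)

-- Two values lying in the same descending run of x and of y would be inverted in both.

n≤ends*ends : ∀ (x y : Permutation′ n) → x ≼ rev y → n ≤ length (ends x) * length (ends y)
n≤ends*ends {n} x y x≼ry = Fin.injective⇒≤ {f = runs} runs-injective
  where
  run : ∀ (x : Permutation′ n) → Fin n → Fin (length (ends x))
  run x v = index (∈-ends x (proj₁ (proj₂ (runEnd x v))))

  runs : Fin n → Fin (length (ends x) * length (ends y))
  runs v = combine (run x v) (run y v)

  run-inverted : ∀ (x : Permutation′ n) {u v} → run x u ≡ run x v → u Fin.< v → v ≺[ x ] u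
  run-inverted x {u} {v} eq with runEnd x u | runEnd x v
  ... | _ , end | _ , end′ with index-injective-≡ (∈-ends x (proj₁ end)) (∈-ends x (proj₁ end′)) eq
  ...   | refl = runEnd-inverted end end′

  ≮-of-equal : ∀ {u v} → runs u ≡ runs v → ¬ u Fin.< v
  ≮-of-equal eq u<v with eqˣ , eqʸ ← Fin.combine-injective _ _ _ _ eq =
    ≺-asym (run-inverted y eqʸ u<v) (rev⁻ (x≼ry u<v (run-inverted x eqˣ u<v)))

  runs-injective : Injective _≡_ _≡_ runs
  runs-injective {u} {v} eq with Fin.<-cmp u v
  ... | tri< u<v _ _ = contradiction u<v (≮-of-equal eq)
  ... | tri≈ _ u≡v _ = u≡v
  ... | tri> _ _ v<u = contradiction v<u (≮-of-equal (sym eq))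

-- Covers in a quotient

Inverted : Permutation′ n → Pred (Fin n × Fin n) 0ℓ
Inverted x (p , q) = q Fin.< p × p ≺[ x ] q

inverted? : ∀ (x : Permutation′ n) → Decidable (Inverted x)
inverted? x (p , q) = (q Fin.<? p) ×-dec ≺? x p q

inversions : Permutation′ n → ℕ
inversions {n} x = length (filter (inverted? x) (cartesianProduct (allFin n) (allFin n)))

inversions-mono-< : ∀ (x y : Permutation′ n) → x ≼ y → q Fin.< p → ¬ p ≺[ x ] q → p ≺[ y ] q →
  inversions x < inversions y
inversions-mono-< {n} {q} {p} x y x≼y q<p p⊀q p≺q =
  length-filter-mono-< (inverted? x) (inverted? y) (λ (q<p , p≺q) → q<p , x≼y q<p p≺q)
    {x = p , q} (∈-cartesianProduct⁺ (∈-allFin p) (∈-allFin q)) (p⊀q ∘ proj₂) (q<p , p≺q)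

lookup-distinct : ∀ {a ℓ} {A : Set a} {_∼_ : Rel A ℓ} {xs} → AllPairs _∼_ xs →
  ∀ {i k} → i Fin.< k → lookup xs i ∼ lookup xs k
lookup-distinct (x∼xs ∷ _)    {zero}  {suc k} _         = All.lookup x∼xs (∈-lookup k)
lookup-distinct (_ ∷ related) {suc i} {suc k} (s≤s i<k) = lookup-distinct related i<k

module Covers {n : ℕ} (R : LatticeCongruence n) where

  open LatticeCongruence R
  open Quotient R using (_⊏_; _⋖_; Adjacent)
  open IsEquivalence isEquivalence public
    using () renaming (refl to ∼-refl; sym to ∼-sym; trans to ∼-trans)

  private
    variable
      x′ y′ j′ m′ X Y ρ : Permutation′ n

  ∨-cong-≼ : x ∼ x′ → y ∼ y′ → IsJoin _≼_ x y j → IsJoin _≼_ x′ y′ j′ → j ∼ j′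
  ∨-cong-≼ x∼x′ y∼y′ j-join j′-join = ∨-cong x∼x′ y∼y′ (isJoin-≼⇒≤ʷ j-join) (isJoin-≼⇒≤ʷ j′-join)

  ∧-cong-≼ : x ∼ x′ → y ∼ y′ → IsMeet _≼_ x y m → IsMeet _≼_ x′ y′ m′ → m ∼ m′
  ∧-cong-≼ x∼x′ y∼y′ m-meet m′-meet = ∧-cong x∼x′ y∼y′ (isMeet-≼⇒≤ʷ m-meet) (isMeet-≼⇒≤ʷ m′-meet)

  ≼∧≽⇒∼ : x ≼ y → y ≼ x → x ∼ y
  ≼∧≽⇒∼ x≼y y≼x = ≈⇒∼ (≼-antisym x≼y y≼x)

  ≼⇒⊏ : x ≼ y → ¬ x ∼ y → x ⊏ y
  ≼⇒⊏ {x} {y} x≼y x≁y = x≁y , x , y , ∼-refl , ∼-refl , ≼⇒≤ʷ x≼y , x≁y ∘ ≈⇒∼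

  ⊏-resp-∼ : x ∼ x′ → y ∼ y′ → x ⊏ y → x′ ⊏ y′
  ⊏-resp-∼ x∼x′ y∼y′ (x≁y , a , b , a∼x , b∼y , a<b) =
    (λ x′∼y′ → x≁y (∼-trans x∼x′ (∼-trans x′∼y′ (∼-sym y∼y′)))) ,
    a , b , ∼-trans a∼x x∼x′ , ∼-trans b∼y y∼y′ , a<b

  ⋖-resp-∼ : x ∼ x′ → y ∼ y′ → x ⋖ y → x′ ⋖ y′
  ⋖-resp-∼ x∼x′ y∼y′ (x⊏y , none) = ⊏-resp-∼ x∼x′ y∼y′ x⊏y , λ (z , x′⊏z , z⊏y′) →
    none (z , ⊏-resp-∼ (∼-sym x∼x′) ∼-refl x′⊏z , ⊏-resp-∼ ∼-refl (∼-sym y∼y′) z⊏y′)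

  adjacent-resp-∼ : x ∼ x′ → y ∼ y′ → Adjacent x y → Adjacent x′ y′
  adjacent-resp-∼ x∼x′ y∼y′ (inj₁ x⋖y) = inj₁ (⋖-resp-∼ x∼x′ y∼y′ x⋖y)
  adjacent-resp-∼ x∼x′ y∼y′ (inj₂ y⋖x) = inj₂ (⋖-resp-∼ y∼y′ x∼x′ y⋖x)

  Minimal : Permutation′ n → Permutation′ n → Set
  Minimal X ρ = ρ ∼ X × (∀ z → z ∼ X → z ≼ ρ → ρ ≼ z)

  -- A strictly smaller member of the class has fewer inversions. As `_∼_` need not be decidable,
  -- the search for one gives existence only up to double negation.
  minimal-exists : ∀ X → ¬ ¬ ∃ (Minimal X)
  minimal-exists X none = go X (On.wellFounded inversions ℕ.<-wellFounded X) ∼-refl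
    where
    go : ∀ x → Acc (_<_ on inversions) x → ¬ x ∼ X
    go x (acc rs) x∼X = none (x , x∼X , minimal)
      where
      minimal : ∀ z → z ∼ X → z ≼ x → x ≼ z
      minimal z z∼X z≼x with descent-below x z z≼x
      ... | inj₁ x≼z = x≼z
      ... | inj₂ (p , q , (q<p , p≺q , _) , p⊀q) =
        contradiction z∼X (go z (rs (inversions-mono-< z x z≼x q<p p⊀q p≺q)))

  -- With `y ≤ x` witnessing the cover, `y` is the meet of `y` and `x`, so `meet y ρ` lies in `Y`.
  -- It misses a descent of `ρ`, and lowering `ρ` there gives a class weakly between `Y` and `X`. By
  -- minimality of `ρ` this class is not `X`, so it cannot differ from `Y`.
  lower-neighbour : Minimal X ρ → Y ⋖ X →
    ∃ λ p → Top ρ p × ¬ ¬ lower ρ p (next ρ p) ∼ Y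
  lower-neighbour {X} {ρ} {Y} (ρ∼X , minimal) ((Y≁X , y , x , y∼Y , x∼X , y≤x , _) , none) =
    result (descent-below ρ (meet y ρ) m≼ρ)
    where
    m≼ρ : meet y ρ ≼ ρ
    m≼ρ = proj₁ (proj₂ (isMeet y ρ))

    m∼Y : meet y ρ ∼ Y
    m∼Y = ∼-trans
      (∼-sym (∧-cong-≼ ∼-refl (∼-trans x∼X (∼-sym ρ∼X)) (isMeet-≼ (≤ʷ⇒≼ y≤x)) (isMeet y ρ))) y∼Y

    result : ρ ≼ meet y ρ ⊎ (∃₂ λ p q → Descent ρ p q × ¬ p ≺[ meet y ρ ] q) →
      ∃ λ p → Top ρ p × ¬ ¬ lower ρ p (next ρ p) ∼ Y
    result (inj₁ ρ≼m) =
      contradiction (∼-trans (∼-sym m∼Y) (∼-trans (≼∧≽⇒∼ m≼ρ ρ≼m) ρ∼X)) Y≁X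
    result (inj₂ (p , q , d , p⊀q)) = p , (q , d) , λ c≁Y → none (lower ρ p (next ρ p) ,
      ⊏-resp-∼ m∼Y ∼-refl (≼⇒⊏ (≼-lower d′ m≼ρ p⊀next) λ m∼c → c≁Y (∼-trans (∼-sym m∼c) m∼Y)) ,
      ⊏-resp-∼ ∼-refl ρ∼X (≼⇒⊏ (lower-≼ d′) λ c∼ρ →
        lower-⋡ d′ (minimal _ (∼-trans c∼ρ ρ∼X) (lower-≼ d′))))
      where
      d′ : Descent ρ p (next ρ p)
      d′ = top⇒descent ρ (q , d)

      p⊀next : ¬ p ≺[ meet y ρ ] next ρ p
      p⊀next = subst (λ q → ¬ p ≺[ meet y ρ ] q) (sym (next-unique d)) p⊀q

  -- A class strictly between those of c = lower x p q and x has, by taking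
  -- meets with x and joins with c, a member between c and x.

  lower-⋖ : Descent x p q → ¬ lower x p q ∼ x → lower x p q ⋖ x
  lower-⋖ {x} {p} {q} d c≁x = ≼⇒⊏ (lower-≼ d) c≁x , none
    where
    c = lower x p q

    none : ¬ ∃ λ Z → c ⊏ Z × Z ⊏ x
    none (Z , (c≁Z , a , z₁ , a∼c , z₁∼Z , a≤z₁ , _) , (Z≁x , z₂ , b , z₂∼Z , b∼x , z₂≤b , _)) =
      conclude (≺? t p q)
      where
      s = meet z₂ x
      t = joinʷ s c

      z₂∼s : z₂ ∼ s
      z₂∼s = ∧-cong-≼ ∼-refl b∼x (isMeet-≼ (≤ʷ⇒≼ z₂≤b)) (isMeet z₂ x)

      t∼Z : t ∼ Z
      t∼Z = ∼-trans (∼-sym (∨-cong-≼ (∼-trans z₁∼Z (∼-trans (∼-sym z₂∼Z) z₂∼s)) a∼c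
        (isJoin-≽ (≤ʷ⇒≼ a≤z₁)) (isJoin s c))) z₁∼Z

      t≼x : t ≼ x
      t≼x = proj₂ (proj₂ (isJoin s c)) x (proj₁ (proj₂ (isMeet z₂ x))) (lower-≼ d)

      c≼t : c ≼ t
      c≼t = proj₁ (proj₂ (isJoin s c))

      conclude : Dec (p ≺[ t ] q) → ⊥
      conclude (yes p≺q) = Z≁x (∼-trans (∼-sym t∼Z) (≼∧≽⇒∼ t≼x (lower-≼-inverted d c≼t p≺q)))
      conclude (no p⊀q)  = c≁Z (∼-trans (≼∧≽⇒∼ c≼t (≼-lower d t≼x p⊀q)) t∼Z)

-- Duality: reversal exchanges lower and upper covers

dual : LatticeCongruence n → LatticeCongruence n
dual R = record
  { _∼_           = _∼_ on rev
  ; isEquivalence = On.isEquivalence rev isEquivalence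
  ; ≈⇒∼           = λ x≈y → ≈⇒∼ (rev-cong x≈y)
  ; ∨-cong        = λ x∼x′ y∼y′ j-join j′-join → ∧-cong-≼ x∼x′ y∼y′
                      (isJoin-rev (isJoin-≤ʷ⇒≼ j-join)) (isJoin-rev (isJoin-≤ʷ⇒≼ j′-join))
  ; ∧-cong        = λ x∼x′ y∼y′ m-meet m′-meet → ∨-cong-≼ x∼x′ y∼y′
                      (isMeet-rev (isMeet-≤ʷ⇒≼ m-meet)) (isMeet-rev (isMeet-≤ʷ⇒≼ m′-meet))
  }
  where
  open LatticeCongruence R
  open Covers R

module Dual {n : ℕ} (R : LatticeCongruence n) where

  open LatticeCongruence R
  open Covers R
  open Quotient R using (_⊏_; _⋖_)
  open Quotient (dual R) using () renaming (_⊏_ to _⊏ᵈ_; _⋖_ to _⋖ᵈ_)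

  private
    variable
      X Y : Permutation′ n

  rev-rev-∼ : rev (rev x) ∼ x
  rev-rev-∼ {x} = ≈⇒∼ (rev-involutive x)

  rev-rev-cong : x ∼ y → rev (rev x) ∼ rev (rev y)
  rev-rev-cong x∼y = ∼-trans rev-rev-∼ (∼-trans x∼y (∼-sym rev-rev-∼))

  ⊏ᵈ⇒⊏ : X ⊏ᵈ Y → rev Y ⊏ rev X
  ⊏ᵈ⇒⊏ (X≁Y , x , y , x∼X , y∼Y , x≤y , x≉y) =
    X≁Y ∘ ∼-sym , rev y , rev x , y∼Y , x∼X ,
    ≼⇒≤ʷ (rev-anti (≤ʷ⇒≼ x≤y)) , λ ry≈rx → x≉y (λ i → sym (rev-≈⁻ ry≈rx i))

  ⊏⇒⊏ᵈ : X ⊏ Y → rev Y ⊏ᵈ rev X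
  ⊏⇒⊏ᵈ (X≁Y , x , y , x∼X , y∼Y , x≤y , x≉y) =
    (λ Y∼X → X≁Y (∼-trans (∼-sym rev-rev-∼) (∼-trans (∼-sym Y∼X) rev-rev-∼))) ,
    rev y , rev x , rev-rev-cong y∼Y , rev-rev-cong x∼X ,
    ≼⇒≤ʷ (rev-anti (≤ʷ⇒≼ x≤y)) , λ ry≈rx → x≉y (λ i → sym (rev-≈⁻ ry≈rx i))
  ⋖⇒⋖ᵈ : X ⋖ Y → rev Y ⋖ᵈ rev X
  ⋖⇒⋖ᵈ (X⊏Y , none) = ⊏⇒⊏ᵈ X⊏Y , λ (Z , Y⊏Z , Z⊏X) → none (rev Z ,
    ⊏-resp-∼ rev-rev-∼ ∼-refl (⊏ᵈ⇒⊏ Z⊏X) , ⊏-resp-∼ ∼-refl rev-rev-∼ (⊏ᵈ⇒⊏ Y⊏Z))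

  ⋖ᵈ⇒⋖ : X ⋖ᵈ Y → rev Y ⋖ rev X
  ⋖ᵈ⇒⋖ {X} {Y} (X⊏Y , none) = ⊏ᵈ⇒⊏ X⊏Y , λ (Z , Y⊏Z , Z⊏X) → none (rev Z ,
    Covers.⊏-resp-∼ (dual R) rev-rev-∼ ∼-refl (⊏⇒⊏ᵈ Z⊏X) ,
    Covers.⊏-resp-∼ (dual R) ∼-refl rev-rev-∼ (⊏⇒⊏ᵈ Y⊏Z))

-- The upper bound

degree-bound : ∀ n s t a b → s + a ≡ n → t + b ≡ n → n ≤ a * b → s + t ≤ 2 * n ∸ ⌈2√ n ⌉
degree-bound n s t a b s+a≡n t+b≡n n≤ab = begin
  s + t                     ≡⟨ m+n∸n≡m (s + t) (a + b) ⟨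
  s + t + (a + b) ∸ (a + b) ≡⟨ cong (_∸ (a + b)) sum ⟩
  -- `⌈2√ n ⌉` is the least `r` with `4 * n ≤ r * r`, and `a + b` is such an `r`.
  2 * n ∸ (a + b)           ≤⟨ ∸-monoʳ-≤ (2 * n) (⌈√⌉-least (4 * n) (a + b) 4n≤[a+b]²) ⟩
  2 * n ∸ ⌈2√ n ⌉           ∎
  where
  open ≤-Reasoning

  sum : s + t + (a + b) ≡ 2 * n
  sum = begin-equality
    s + t + (a + b)       ≡⟨ regroup s t a b ⟩
    (s + a) + (t + b + 0) ≡⟨ cong₂ (λ k l → k + (l + 0)) s+a≡n t+b≡n ⟩
    2 * n                 ∎
    where
    regroup : ∀ s t a b → s + t + (a + b) ≡ (s + a) + (t + b + 0)
    regroup = solve-∀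

  -- The two sides differ by the square of `d`, the difference of `b` and `a`.
  4ab≤[a+b]² : ∀ {a b} → a ≤ b → 4 * (a * b) ≤ (a + b) * (a + b)
  4ab≤[a+b]² {a} {b} a≤b with d , refl ← m≤n⇒∃[o]m+o≡n a≤b =
    ≤-trans (m≤m+n _ (d * d)) (≤-reflexive (square a d))
    where
    square : ∀ a d → 4 * (a * (a + d)) + d * d ≡ (a + (a + d)) * (a + (a + d))
    square = solve-∀

  4n≤[a+b]² : 4 * n ≤ (a + b) * (a + b)
  4n≤[a+b]² = ≤-trans (*-monoʳ-≤ 4 n≤ab) ([ 4ab≤[a+b]² , swapped ]′ (≤-total a b))
    where
    swapped : b ≤ a → 4 * (a * b) ≤ (a + b) * (a + b)
    swapped b≤a = subst₂ _≤_ (cong (4 *_) (*-comm b a)) (cong (λ k → k * k) (+-comm b a)) (4ab≤[a+b]² b≤a)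

join-injective : ∀ k l {s t : Fin k ⊎ Fin l} → join k l s ≡ join k l t → s ≡ t
join-injective k l {s} {t} eq =
  trans (sym (Fin.splitAt-join k l s)) (trans (cong (Fin.splitAt k) eq) (Fin.splitAt-join k l t))

module UpperBound {n : ℕ} (R : LatticeCongruence n) (X : Permutation′ n) where

  open LatticeCongruence R
  open Quotient R using (_⋖_; Adjacent)
  open Covers R
  open Dual R
  private module D = Covers (dual R)

  -- Both `ρ` and `rev σ` lie in the class of `X`, hence so does their meet. As the meet is below
  -- `ρ`, minimality puts `ρ` below it, and so below `rev σ`.
  minimal≼maximal : ∀ {ρ σ} → Minimal X ρ → D.Minimal (rev X) σ → ρ ≼ rev σ
  minimal≼maximal {ρ} {σ} (ρ∼X , minimal) (σ∼X , _) =
    ≼-trans (minimal _ m∼X (proj₁ (isMeet ρ (rev σ)))) (proj₁ (proj₂ (isMeet ρ (rev σ))))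
    where
    m∼X : meet ρ (rev σ) ∼ X
    m∼X = ∧-cong-≼ ρ∼X (∼-trans σ∼X rev-rev-∼) (isMeet ρ (rev σ)) (isMeet-≼ ≼-refl)

  -- The double negation is the one in `lower-neighbour`. It is harmless, since distinctness of
  -- neighbours is itself a negation.
  Listed : List (Fin n) → (Fin n → Permutation′ n) → Permutation′ n → Set
  Listed ps f Y = ∃ λ p → p List.∈ ps × ¬ ¬ f p ∼ Y

  module _ {ps : List (Fin n)} {f : Fin n → Permutation′ n} where

    rank : ∀ {Y} → Listed ps f Y → Fin (length ps)
    rank (_ , p∈ps , _) = index p∈ps

    rank-injective : ∀ {Y Z} (y : Listed ps f Y) (z : Listed ps f Z) → rank y ≡ rank z → ¬ ¬ Y ∼ Z
    rank-injective (_ , p∈ps , fp∼Y) (_ , q∈ps , fq∼Z) eq Y≁Z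
      with refl ← index-injective-≡ p∈ps q∈ps eq =
      fp∼Y λ fp∼Y → fq∼Z λ fp∼Z → Y≁Z (∼-trans (∼-sym fp∼Y) fp∼Z)

  module _ {ρ σ} (ρ-min : Minimal X ρ) (σ-min : D.Minimal (rev X) σ) where

    abstract

      below : ∀ {Y} → Y ⋖ X → Listed (tops ρ) (λ p → lower ρ p (next ρ p)) Y
      below {Y} Y⋖X with lower-neighbour {X} {ρ} {Y} ρ-min Y⋖X
      ... | p , top , c∼Y = p , ∈-tops ρ top , c∼Y

      above : ∀ {Y} → X ⋖ Y → Listed (tops σ) (λ p → rev (lower σ p (next σ p))) Y
      above {Y} X⋖Y with D.lower-neighbour {rev X} {σ} {rev Y} σ-min (⋖⇒⋖ᵈ X⋖Y)
      ... | p , top , rc∼Y =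
        p , ∈-tops σ top , λ rc≁Y → rc∼Y λ rc∼rrY → rc≁Y (∼-trans rc∼rrY rev-rev-∼)

    code : ∀ {Y} → Adjacent X Y → Fin (length (tops ρ)) ⊎ Fin (length (tops σ))
    code (inj₁ X⋖Y) = inj₂ (rank (above X⋖Y))
    code (inj₂ Y⋖X) = inj₁ (rank (below Y⋖X))

    code-injective : ∀ {Y Z} (adj : Adjacent X Y) (adj′ : Adjacent X Z) →
      code adj ≡ code adj′ → ¬ ¬ Y ∼ Z
    code-injective (inj₁ X⋖Y) (inj₁ X⋖Z) eq =
      rank-injective (above X⋖Y) (above X⋖Z) (inj₂-injective eq)
    code-injective (inj₂ Y⋖X) (inj₂ Z⋖X) eq =
      rank-injective (below Y⋖X) (below Z⋖X) (inj₁-injective eq)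

    degree≤tops+tops : DegreeAtMost R X (length (tops ρ) + length (tops σ))
    degree≤tops+tops Ys distinct adjacent = Fin.injective⇒≤ {f = codeAt} codeAt-injective
      where
      neighbour : ∀ i → Adjacent X (lookup Ys i)
      neighbour i = All.lookup adjacent (∈-lookup i)

      codeAt : Fin (length Ys) → Fin (length (tops ρ) + length (tops σ))
      codeAt i = join (length (tops ρ)) (length (tops σ)) (code (neighbour i))

      codes-equal : ∀ i k → codeAt i ≡ codeAt k → ¬ ¬ lookup Ys i ∼ lookup Ys k
      codes-equal i k eq = code-injective (neighbour i) (neighbour k)
        (join-injective (length (tops ρ)) (length (tops σ)) eq)

      codeAt-injective : Injective _≡_ _≡_ codeAt
      codeAt-injective {i} {k} eq with Fin.<-cmp i k
      ... | tri< i<k _ _ = contradiction (lookup-distinct distinct i<k) (codes-equal i k eq)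
      ... | tri≈ _ i≡k _ = i≡k
      ... | tri> _ _ k<i = contradiction (lookup-distinct distinct k<i) (codes-equal k i (sym eq))

  degree≤ : DegreeAtMost R X (2 * n ∸ ⌈2√ n ⌉)
  -- The inequality is decidable, hence stable, so `ρ` and `σ` may be used although they exist only
  -- up to double negation.
  degree≤ Ys distinct adjacent = decidable-stable (_ ≤? _) λ ≰ →
    minimal-exists X λ (ρ , ρ-min) → D.minimal-exists (rev X) λ (σ , σ-min) →
    ≰ (≤-trans (degree≤tops+tops {ρ} {σ} ρ-min σ-min Ys distinct adjacent)
      (degree-bound n (length (tops ρ)) (length (tops σ)) (length (ends ρ)) (length (ends σ))
        (tops+ends≡n ρ) (tops+ends≡n σ) (n≤ends*ends ρ σ (minimal≼maximal {ρ} {σ} ρ-min σ-min))))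

-- The congruences of bounded arcs

≈⇒≼ : x ≈ y → x ≼ y
≈⇒≼ {x = x} {y} x≈y _ (before i<j) = before (subst₂ Fin._<_ (same _) (same _) i<j)
  where
  same : ∀ u → x ⟨$⟩ˡ u ≡ y ⟨$⟩ˡ u
  same u = trans (sym (inverseˡ y))
    (cong (y ⟨$⟩ˡ_) (trans (sym (x≈y (x ⟨$⟩ˡ u))) (inverseʳ x)))

module _ {ℓ} {P : Pred (Fin n) ℓ} (P? : Decidable P) where

  subset : Subset n
  subset = tabulate (does ∘ P?)

  ∈-subset⁺ : P v → v ∈ subset
  ∈-subset⁺ {v} pv =
    lookup⇒[]= v subset (trans (lookup∘tabulate (does ∘ P?) v) (dec-true (P? v) pv))

  ∈-subset⁻ : v ∈ subset → P v
  ∈-subset⁻ {v} v∈ with P? v | trans (sym (lookup∘tabulate (does ∘ P?) v)) ([]=⇒lookup v∈)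
  ... | yes pv | _ = pv

-- An arc joins the values s < t and passes, for each value strictly between
-- them, on one of its two sides, as given by S; only s < v < t matter in S.
-- Its inversions are those of a join-irreducible permutation, and x lies above
-- this join-irreducible when it has all of them.

ArcInversion : Subset n → Fin n → Fin n → Fin n → Fin n → Set
ArcInversion S s t p q =
  s Fin.≤ q × q Fin.< p × p Fin.≤ t × (p ∈ S ⊎ p ≡ t) × (q ∉ S ⊎ q ≡ s)

Above : Subset n → Fin n → Fin n → Permutation′ n → Set
Above S s t x = ∀ p q → ArcInversion S s t p q → p ≺[ x ] q

above? : ∀ (S : Subset n) s t → Decidable (Above S s t)
above? S s t x = Fin.all? λ p → Fin.all? λ q → arcInversion? p q →-dec ≺? x p q
  where
  arcInversion? : Binary.Decidable (ArcInversion S s t)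
  arcInversion? p q = (s Fin.≤? q) ×-dec (q Fin.<? p) ×-dec (p Fin.≤? t) ×-dec
    ((p Subset.∈? S) ⊎-dec (p Fin.≟ t)) ×-dec (¬? (q Subset.∈? S) ⊎-dec (q Fin.≟ s))

above-mono : ∀ {S : Subset n} {s t} → x ≼ y → Above S s t x → Above S s t y
above-mono x≼y above p q arc@(_ , q<p , _) = x≼y q<p (above p q arc)

-- An ascent from `q` to `p` starts outside `S` or at `s` and ends in `S` or at `t`. Some single
-- step crosses over in this way, and its pair is an arc inversion, so it is inverted in both `x`
-- and `y`.
above-meet : ∀ {S : Subset n} {s t} → Above S s t x → Above S s t y → Above S s t (meet x y)
above-meet {x = x} {y} {S} {s} {t} above-x above-y p q (s≤q , q<p , p≤t , p-side , q-side) =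
  ¬ascent⇒inverted q<p (¬ascent s≤q q-side)
  where
  open Meet x y using (Step; Ascent; ascent⇒<; ¬ascent⇒inverted)

  ¬step : s Fin.≤ u → v Fin.≤ t → v ∈ S ⊎ v ≡ t → u ∉ S ⊎ u ≡ s → ¬ Step u v
  ¬step s≤u v≤t v-side u-side (u<v , inj₁ u≺v) =
    ≺-asym u≺v (above-x _ _ (s≤u , u<v , v≤t , v-side , u-side))
  ¬step s≤u v≤t v-side u-side (u<v , inj₂ u≺v) =
    ≺-asym u≺v (above-y _ _ (s≤u , u<v , v≤t , v-side , u-side))

  ¬ascent : s Fin.≤ u → u ∉ S ⊎ u ≡ s → ¬ Ascent u p
  ¬ascent s≤u u-side [ step ] = ¬step s≤u p≤t p-side u-side step
  ¬ascent s≤u u-side (_∷_ {y = w} step ascent) with w Subset.∈? S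
  ... | yes w∈S = ¬step s≤u (Fin.≤-trans (<⇒≤ (ascent⇒< ascent)) p≤t) (inj₁ w∈S) u-side step
  ... | no w∉S  = ¬ascent (Fin.≤-trans s≤u (<⇒≤ (proj₁ step))) (inj₁ w∉S) ascent

module ArcCongruence (n b : ℕ) where

  infix 4 _⊑_ _∼_

  -- Only the join-irreducibles of arcs of length at most `b` are compared; the longer arcs are the
  -- contracted ones.
  _⊑_ _∼_ : Rel (Permutation′ n) 0ℓ
  x ⊑ y = ∀ S s t → toℕ t ≤ toℕ s + b → Above S s t x → Above S s t y
  x ∼ y = x ⊑ y × y ⊑ x

  ⊑? : Binary.Decidable _⊑_
  ⊑? x y = map′
    (λ none S → decidable-stable (at? S) λ fails → none (S , fails))
    (λ x⊑y (S , fails) → fails (x⊑y S))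
    (¬? (Subset.anySubset? λ S → ¬? (at? S)))
    where
    at? : ∀ S → Dec (∀ s t → toℕ t ≤ toℕ s + b → Above S s t x → Above S s t y)
    at? S = Fin.all? λ s → Fin.all? λ t →
      (toℕ t ≤? toℕ s + b) →-dec above? S s t x →-dec above? S s t y

  ∼? : Binary.Decidable _∼_
  ∼? x y = ⊑? x y ×-dec ⊑? y x

  ⊑-trans : x ⊑ y → y ⊑ z → x ⊑ z
  ⊑-trans x⊑y y⊑z S s t short = y⊑z S s t short ∘ x⊑y S s t short

  ≼⇒⊑ : x ≼ y → x ⊑ y
  ≼⇒⊑ x≼y S s t short = above-mono x≼y

  -- If p, q is an inversion of the arc (S , s , t) that rev x lacks, and p − q
  -- is minimal, then x, and with it y, lies above the arc (∁ S , q , p).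

  rev-⊑ : x ⊑ y → rev y ⊑ rev x
  rev-⊑ {x} {y} x⊑y S s t short above p q arc = go (toℕ p) p q (m≤n+m (toℕ p) (toℕ q)) arc
    where
    -- The number `d` bounds `p − q` and is what the recursion decreases.
    go : ∀ d p q → toℕ p ≤ toℕ q + d → ArcInversion S s t p q → p ≺[ rev x ] q
    go zero p q p≤q+0 (_ , q<p , _) =
      contradiction (subst (toℕ p ≤_) (+-identityʳ (toℕ q)) p≤q+0) (<⇒≱ q<p)
    go (suc d) p q p≤q+1+d arc@(s≤q , q<p , p≤t , p-side , q-side) with ≺? x q p
    ... | yes q≺p = rev⁺ q≺p
    ... | no q⊀p  = contradiction
      (x⊑y (∁ S) q p p≤q+b above-x p q (Fin.≤-refl , q<p , Fin.≤-refl , inj₂ refl , inj₂ refl))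
      (≺-asym (rev⁻ (above p q arc)))
      where
      p≤q+b : toℕ p ≤ toℕ q + b
      p≤q+b = ≤-trans p≤t (≤-trans short (+-monoˡ-≤ b s≤q))

      p≺q : p ≺[ x ] q
      p≺q = ⊀⇒≻ (Fin.<⇒≢ q<p) q⊀p

      -- For `v` in `∁ S` other than `p`, the pair `p`, `v` is an inversion of the arc with a
      -- smaller difference, so by recursion `rev x` has it. In `bottom-last` the same holds for
      -- `v`, `q`.
      top-first : ∀ {v} → q Fin.< v → v Fin.≤ p → v ∈ ∁ S ⊎ v ≡ p → v ≡ p ⊎ v ≺[ x ] p
      top-first q<v v≤p (inj₂ v≡p) = inj₁ v≡p
      top-first {v} q<v v≤p (inj₁ v∈∁S) with v Fin.≟ p
      ... | yes v≡p = inj₁ v≡p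
      ... | no v≢p = inj₂ (rev⁻ (go d p v
        (≤-trans p≤q+1+d (subst (_≤ toℕ v + d) (sym (+-suc (toℕ q) d)) (+-monoˡ-≤ d q<v)))
        (Fin.≤-trans s≤q (<⇒≤ q<v) , Fin.≤∧≢⇒< v≤p v≢p , p≤t , p-side ,
         inj₁ (Subset.x∈∁p⇒x∉p v∈∁S))))

      bottom-last : ∀ {v} → q Fin.≤ v → v Fin.< p → v ∉ ∁ S ⊎ v ≡ q → q ≡ v ⊎ q ≺[ x ] v
      bottom-last q≤v v<p (inj₂ v≡q) = inj₁ (sym v≡q)
      bottom-last {v} q≤v v<p (inj₁ v∉∁S) with q Fin.≟ v
      ... | yes q≡v = inj₁ q≡v
      ... | no q≢v = inj₂ (rev⁻ (go d v q
        (≤-pred (subst (toℕ v <_) (+-suc (toℕ q) d) (≤-trans v<p p≤q+1+d)))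
        (s≤q , Fin.≤∧≢⇒< q≤v q≢v , Fin.≤-trans (<⇒≤ v<p) p≤t ,
         inj₁ (Subset.x∉∁p⇒x∈p v∉∁S) , q-side)))

      chain : ∀ {u v} → u ≡ p ⊎ u ≺[ x ] p → q ≡ v ⊎ q ≺[ x ] v → u ≺[ x ] v
      chain (inj₁ refl) (inj₁ refl) = p≺q
      chain (inj₁ refl) (inj₂ q≺v)  = ≺-trans p≺q q≺v
      chain (inj₂ u≺p)  (inj₁ refl) = ≺-trans u≺p p≺q
      chain (inj₂ u≺p)  (inj₂ q≺v)  = ≺-trans u≺p (≺-trans p≺q q≺v)

      above-x : Above (∁ S) q p x
      above-x u v (q≤v , v<u , u≤p , u-side , v-side) =
        chain (top-first (≤-trans (s≤s q≤v) v<u) u≤p u-side)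
              (bottom-last q≤v (≤-trans v<u u≤p) v-side)

  rev-⊑⁻ : rev x ⊑ rev y → y ⊑ x
  rev-⊑⁻ rx⊑ry = ⊑-trans (≼⇒⊑ ≼-rev-rev) (⊑-trans (rev-⊑ rx⊑ry) (≼⇒⊑ rev-rev-≼))

  ∧-mono : ∀ {x′ y′ m′} → x ⊑ x′ → y ⊑ y′ → IsMeet _≼_ x y m → IsMeet _≼_ x′ y′ m′ → m ⊑ m′
  ∧-mono {x′ = x′} {y′} x⊑x′ y⊑y′ (m≼x , m≼y , _) (_ , _ , greatest) S s t short above =
    above-mono (greatest (meet x′ y′) (proj₁ (isMeet x′ y′)) (proj₁ (proj₂ (isMeet x′ y′))))
      (above-meet (x⊑x′ S s t short (above-mono m≼x above)) (y⊑y′ S s t short (above-mono m≼y above)))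

  -- Reversal turns the joins into meets and, by `rev-⊑`, turns `_⊑_` around.
  ∨-mono : ∀ {x′ y′ j′} → x ⊑ x′ → y ⊑ y′ → IsJoin _≼_ x y j → IsJoin _≼_ x′ y′ j′ → j ⊑ j′
  ∨-mono x⊑x′ y⊑y′ j-join j′-join =
    rev-⊑⁻ (∧-mono (rev-⊑ x⊑x′) (rev-⊑ y⊑y′) (isJoin-rev j′-join) (isJoin-rev j-join))

  congruence : LatticeCongruence n
  congruence = record
    { _∼_           = _∼_
    ; isEquivalence = record
      { refl  = ≼⇒⊑ ≼-refl , ≼⇒⊑ ≼-refl
      ; sym   = λ (x⊑y , y⊑x) → y⊑x , x⊑y
      ; trans = λ (x⊑y , y⊑x) (y⊑z , z⊑y) → ⊑-trans x⊑y y⊑z , ⊑-trans z⊑y y⊑x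
      }
    ; ≈⇒∼    = λ x≈y → ≼⇒⊑ (≈⇒≼ x≈y) , ≼⇒⊑ (≈⇒≼ (sym ∘ x≈y))
    ; ∨-cong = λ (x⊑x′ , x′⊑x) (y⊑y′ , y′⊑y) j-join j′-join →
        ∨-mono x⊑x′ y⊑y′ (isJoin-≤ʷ⇒≼ j-join) (isJoin-≤ʷ⇒≼ j′-join) ,
        ∨-mono x′⊑x y′⊑y (isJoin-≤ʷ⇒≼ j′-join) (isJoin-≤ʷ⇒≼ j-join)
    ; ∧-cong = λ (x⊑x′ , x′⊑x) (y⊑y′ , y′⊑y) m-meet m′-meet →
        ∧-mono x⊑x′ y⊑y′ (isMeet-≤ʷ⇒≼ m-meet) (isMeet-≤ʷ⇒≼ m′-meet) ,
        ∧-mono x′⊑x y′⊑y (isMeet-≤ʷ⇒≼ m′-meet) (isMeet-≤ʷ⇒≼ m-meet)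
    }

  -- The arc from `q` to `p` whose set `S` consists of the values that `x` lists before `q` tells
  -- them apart: `x` lies above it, while `lower x p q` lacks its inversion of `p` and `q`.
  lower-⋢ : Descent x p q → toℕ p ≤ toℕ q + b → ¬ x ⊑ lower x p q
  lower-⋢ {x} {p} {q} (q<p , p≺q , _) short x⊑lower = ≺-asym (lower-swapped p≺q)
    (x⊑lower S q p short above p q (Fin.≤-refl , q<p , Fin.≤-refl , inj₂ refl , inj₂ refl))
    where
    before? : Decidable (_≺[ x ] q)
    before? w = ≺? x w q

    S : Subset n
    S = subset before?

    before-q : u ∈ S ⊎ u ≡ p → u ≺[ x ] q
    before-q (inj₁ u∈S)  = ∈-subset⁻ before? u∈S
    before-q (inj₂ refl) = p≺q

    above : Above S q p x
    above u v (_ , _ , _ , u-side , inj₂ refl) = before-q u-side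
    above u v (_ , _ , _ , u-side , inj₁ v∉S) with v Fin.≟ q
    ... | yes refl = before-q u-side
    ... | no v≢q   = ≺-trans (before-q u-side) (⊀⇒≻ v≢q (v∉S ∘ ∈-subset⁺ before?))

-- Sorting the values by a key

module SortBy {n : ℕ} (f : Fin n → ℕ) where

  private
    _⊲_ : Rel (Fin n) 0ℓ
    u ⊲ v = f u < f v ⊎ (f u ≡ f v × v Fin.< u)

    ⊲-trans : Transitive _⊲_
    ⊲-trans (inj₁ fu<fv) (inj₁ fv<fw) = inj₁ (<-trans fu<fv fv<fw)
    ⊲-trans (inj₁ fu<fv) (inj₂ (fv≡fw , _)) = inj₁ (<-≤-trans fu<fv (≤-reflexive fv≡fw))
    ⊲-trans (inj₂ (fu≡fv , _)) (inj₁ fv<fw) = inj₁ (≤-<-trans (≤-reflexive fu≡fv) fv<fw)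
    ⊲-trans (inj₂ (fu≡fv , v<u)) (inj₂ (fv≡fw , w<v)) =
      inj₂ (trans fu≡fv fv≡fw , Fin.<-trans w<v v<u)

    ⊲-asym : u ⊲ v → ¬ v ⊲ u
    ⊲-asym (inj₁ fu<fv)         (inj₁ fv<fu)         = <-asym fu<fv fv<fu
    ⊲-asym (inj₁ fu<fv)         (inj₂ (fv≡fu , _))   = <-irrefl (sym fv≡fu) fu<fv
    ⊲-asym (inj₂ (fu≡fv , _))   (inj₁ fv<fu)         = <-irrefl (sym fu≡fv) fv<fu
    ⊲-asym (inj₂ (_ , v<u))     (inj₂ (_ , u<v))     = Fin.<-asym u<v v<u

    tri⁺ : u ⊲ v → Tri (u ⊲ v) (u ≡ v) (v ⊲ u)
    tri⁺ u⊲v = tri< u⊲v (λ { refl → ⊲-asym u⊲v u⊲v }) (⊲-asym u⊲v)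

    tri⁻ : v ⊲ u → Tri (u ⊲ v) (u ≡ v) (v ⊲ u)
    tri⁻ v⊲u = tri> (⊲-asym v⊲u) (λ { refl → ⊲-asym v⊲u v⊲u }) v⊲u

    ⊲-cmp : Trichotomous _≡_ _⊲_
    ⊲-cmp u v with <-cmp (f u) (f v) | Fin.<-cmp u v
    ... | tri< fu<fv _ _ | _              = tri⁺ (inj₁ fu<fv)
    ... | tri> _ _ fv<fu | _              = tri⁻ (inj₁ fv<fu)
    ... | tri≈ _ fu≡fv _ | tri< u<v _ _   = tri⁻ (inj₂ (sym fu≡fv , u<v))
    ... | tri≈ _ fu≡fv _ | tri> _ _ v<u   = tri⁺ (inj₂ (fu≡fv , v<u))
    ... | tri≈ _ fu≡fv _ | tri≈ _ refl _  = tri≈ (λ u⊲u → ⊲-asym u⊲u u⊲u) refl (λ u⊲u → ⊲-asym u⊲u u⊲u)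

    module Order = FromOrder ⊲-trans ⊲-cmp

  sorted : Permutation′ n
  sorted = Order.perm

  sorted⁺ : f u < f v ⊎ (f u ≡ f v × v Fin.< u) → u ≺[ sorted ] v
  sorted⁺ = Order.⊲⇒≺

  sorted⁻ : u ≺[ sorted ] v → f u < f v ⊎ (f u ≡ f v × v Fin.< u)
  sorted⁻ = Order.≺⇒⊲

  sorted⇒≤ : u ≺[ sorted ] v → f u ≤ f v
  sorted⇒≤ u≺v = [ <⇒≤ , ≤-reflexive ∘ proj₁ ]′ (sorted⁻ u≺v)

  -- The value following `v` comes no later than `u`, so its key is squeezed between the equal keys
  -- of `v` and `u`. Within one key the values decrease.
  same-key⇒top : f u ≡ f v → u Fin.< v → Top sorted v
  same-key⇒top {u} {v} fu≡fv u<v with successor sorted (sorted⁺ (inj₂ (sym fu≡fv , u<v)))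
  ... | q , c , q≼u = q , descends (sorted⁻ (proj₁ c)) , c
    where
    fq≤fv : q ≡ u ⊎ q ≺[ sorted ] u → f q ≤ f v
    fq≤fv (inj₁ refl) = ≤-reflexive fu≡fv
    fq≤fv (inj₂ q≺u)  = ≤-trans (sorted⇒≤ q≺u) (≤-reflexive fu≡fv)

    descends : f v < f q ⊎ (f v ≡ f q × q Fin.< v) → q Fin.< v
    descends (inj₁ fv<fq)     = contradiction fv<fq (≤⇒≯ (fq≤fv q≼u))
    descends (inj₂ (_ , q<v)) = q<v

  -- By `same-key⇒top`, each key has at most one value that is not a descent top, so the key serves
  -- as its code.
  n≤keys+tops : ∀ {k} → (∀ u → f u < k) → n ≤ k + length (tops sorted)
  n≤keys+tops {k} f<k = Fin.injective⇒≤ {f = λ v → join k _ (code v (top? sorted v))}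
    λ {u} {v} eq → code-injective (top? sorted u) (top? sorted v) (join-injective k _ eq)
    where
    code : ∀ v → Dec (Top sorted v) → Fin k ⊎ Fin (length (tops sorted))
    code v (yes top) = inj₂ (index (∈-tops sorted top))
    code v (no _)    = inj₁ (fromℕ< (f<k v))

    code-injective : ∀ {u v} (u? : Dec (Top sorted u)) (v? : Dec (Top sorted v)) →
      code u u? ≡ code v v? → u ≡ v
    code-injective (yes top) (yes top′) eq =
      index-injective-≡ (∈-tops sorted top) (∈-tops sorted top′) (inj₂-injective eq)
    code-injective {u} {v} (no ¬top) (no ¬top′) eq
      with Fin.<-cmp u v | Fin.fromℕ<-injective (f u) (f v) (f<k u) (f<k v) (inj₁-injective eq)
    ... | tri≈ _ u≡v _ | _     = u≡v
    ... | tri< u<v _ _ | fu≡fv = contradiction (same-key⇒top fu≡fv u<v) ¬top′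
    ... | tri> _ _ v<u | fu≡fv = contradiction (same-key⇒top (sym fu≡fv) v<u) ¬top

-- The lower bound

allPairs-with : ∀ {a ℓ ℓ′} {A : Set a} {P : Pred A ℓ} {_~_ : Rel A ℓ′} {xs} →
  All P xs → AllPairs _~_ xs → AllPairs (λ x y → P x × P y × x ~ y) xs
allPairs-with []         []           = []
allPairs-with (px ∷ pxs) (x~xs ∷ ~xs) =
  All.zipWith (λ (py , x~y) → px , py , x~y) (pxs , x~xs) ∷ allPairs-with pxs ~xs

lowerings : Permutation′ n → List (Permutation′ n)
lowerings x = map (λ p → lower x p (next x p)) (tops x)

all-tops : ∀ (x : Permutation′ n) → All (Top x) (tops x)
all-tops x = All.all-filter (top? x) (allFin _)

StrictDescents : LatticeCongruence n → Permutation′ n → Set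
StrictDescents R x = ∀ {p q} → Descent x p q → ¬ lower x p q ∼ x
  where open LatticeCongruence R

module Lowerings {n : ℕ} (R : LatticeCongruence n) {x : Permutation′ n} (strict : StrictDescents R x) where

  open LatticeCongruence R
  open Quotient R using (_⋖_)
  open Covers R

  lowerings-distinct : AllPairs (λ c d → ¬ c ∼ d) (lowerings x)
  lowerings-distinct = AllPairs.map⁺ (AllPairs.map distinct
    (allPairs-with (all-tops x) (filter⁺ (top? x) (allFin⁺ n))))
    where
    distinct : ∀ {p q} → Top x p × Top x q × p ≢ q →
      ¬ lower x p (next x p) ∼ lower x q (next x q)
    -- Here `x` is the join of `c` and `d`; if `c ∼ d`, it is congruent to the join of `c` with
    -- itself, against strictness at `p`.
    distinct (top-p , top-q , p≢q) c∼d = strict d-p (∼-sym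
      (∨-cong-≼ ∼-refl (∼-sym c∼d) (isJoin-lower d-p d-q p≢q) (isJoin-≼ ≼-refl)))
      where
      d-p = top⇒descent x top-p
      d-q = top⇒descent x top-q

  lowerings-⋖ : All (_⋖ x) (lowerings x)
  lowerings-⋖ = All.map⁺ (All.map
    (λ top → lower-⋖ (top⇒descent x top) (strict (top⇒descent x top))) (all-tops x))

  lowerings-≼ : All (λ c → c ≼ x × ¬ c ∼ x) (lowerings x)
  lowerings-≼ = All.map⁺ (All.map
    (λ top → (λ {_} {_} → lower-≼ (top⇒descent x top)) , strict (top⇒descent x top)) (all-tops x))

module _ {n : ℕ} (R : LatticeCongruence n) (∼? : Binary.Decidable (LatticeCongruence._∼_ R)) where

  open LatticeCongruence R
  open Quotient R using (classes; Adjacent)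
  open import Data.List.Membership.Setoid classes using () renaming (_∈_ to _∈ᶜ_)
  open Covers R

  -- A neighbour missing from `Ys` could be added to it, exceeding the bound `d`. Decidability of
  -- `_∼_` lets this show that none is missing.
  longest⇒hasDegree : ∀ {X Ys d} → AllPairs (λ Y Z → ¬ Y ∼ Z) Ys → All (Adjacent X) Ys →
    DegreeAtMost R X d → d ≤ length Ys → HasDegree R X d
  longest⇒hasDegree {X} {Ys} {d} distinct adjacent bound d≤length =
    Ys , distinct , (λ Y → mk⇔ listed adjacent′) , ≤-antisym (bound Ys distinct adjacent) d≤length
    where
    listed : ∀ {Y} → Adjacent X Y → Y ∈ᶜ Ys
    listed {Y} adj with Any.any? (∼? Y) Ys
    ... | yes Y∈ = Y∈
    ... | no Y∉  = contradiction (bound (Y ∷ Ys) (All.¬Any⇒All¬ Ys Y∉ ∷ distinct) (adj ∷ adjacent))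
      (<⇒≱ (s≤s d≤length))

    adjacent′ : ∀ {Y} → Y ∈ᶜ Ys → Adjacent X Y
    adjacent′ Y∈ with All.lookupAny adjacent Y∈
    ... | adj , Y∼Z = adjacent-resp-∼ ∼-refl (∼-sym Y∼Z) adj

module LowerBound {n : ℕ} (R : LatticeCongruence n) (∼? : Binary.Decidable (LatticeCongruence._∼_ R))
  {ρ σ : Permutation′ n} (ρ∼rσ : LatticeCongruence._∼_ R ρ (rev σ))
  (ρ-strict : StrictDescents R ρ) (σ-strict : StrictDescents (dual R) σ) where

  open LatticeCongruence R
  open Quotient R using (Adjacent)
  open Covers R
  open Dual R
  private
    module Low = Lowerings R ρ-strict
    module Up  = Lowerings (dual R) σ-strict

  neighbours : List (Permutation′ n)
  neighbours = lowerings ρ ++ map rev (lowerings σ)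

  neighbours-distinct : AllPairs (λ c d → ¬ c ∼ d) neighbours
  neighbours-distinct = AllPairs.++⁺ Low.lowerings-distinct (AllPairs.map⁺ Up.lowerings-distinct)
    (All.map (λ c≺ρ → All.map⁺ (All.map (λ d≺σ → separated c≺ρ d≺σ) Up.lowerings-≼)) Low.lowerings-≼)
    where
    -- The meet of `rev σ` and `rev d` is `rev σ`, and that of `ρ` and `c` is `c`. So `c ∼ rev d`
    -- would make `c` congruent to `rev σ`, hence to `ρ`.
    separated : ∀ {c d} → c ≼ ρ × ¬ c ∼ ρ → d ≼ σ × ¬ rev d ∼ rev σ → ¬ c ∼ rev d
    separated (c≼ρ , c≁ρ) (d≼σ , _) c∼rd = c≁ρ (∼-sym (∼-trans ρ∼rσ
      (∧-cong-≼ (∼-sym ρ∼rσ) (∼-sym c∼rd) (isMeet-≼ (rev-anti d≼σ)) (isMeet-≽ c≼ρ))))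

  neighbours-adjacent : All (Adjacent ρ) neighbours
  neighbours-adjacent = All.++⁺ (All.map inj₂ Low.lowerings-⋖)
    (All.map⁺ (All.map (λ d⋖σ → inj₁ (⋖-resp-∼ (∼-sym ρ∼rσ) ∼-refl (⋖ᵈ⇒⋖ d⋖σ))) Up.lowerings-⋖))

  length-neighbours : length neighbours ≡ length (tops ρ) + length (tops σ)
  length-neighbours = trans (length-++ (lowerings ρ)) (cong₂ _+_ (length-map _ (tops ρ))
    (trans (length-map rev (lowerings σ)) (length-map _ (tops σ))))

  hasDegree : ∀ {d} → DegreeAtMost R ρ d → d ≤ length (tops ρ) + length (tops σ) → HasDegree R ρ d
  hasDegree {d} bound d≤ = longest⇒hasDegree R ∼? neighbours-distinct neighbours-adjacent bound
    (subst (d ≤_) (sym length-neighbours) d≤)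

-- Blocks and residues: a class attaining the bound

module Grid {n a b : ℕ} .{{_ : NonZero b}} (n≤ab : n ≤ a * b) where

  private
    block residue : Fin n → ℕ
    block u   = toℕ u / b
    residue u = toℕ u % b

    module Blocks   = SortBy block
    module Residues = SortBy residue
    module Arcs     = ArcCongruence n b

  open Arcs using (_⊑_; _∼_)

  ρ σ : Permutation′ n
  ρ = Blocks.sorted
  σ = Residues.sorted

  private
    ≡residue+block*b : ∀ (u : Fin n) → toℕ u ≡ residue u + block u * b
    ≡residue+block*b u = m≡m%n+[m/n]*n (toℕ u) b

    block-mono : v Fin.≤ u → block v ≤ block u
    block-mono = /-monoˡ-≤ b

    block<a : ∀ u → block u < a
    block<a u = m<n*o⇒m/o<n (<-≤-trans (Fin.toℕ<n u) n≤ab)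

    residue<b : ∀ u → residue u < b
    residue<b u = m%n<n (toℕ u) b

  open ≤-Reasoning

  ρ-descent-short : Descent ρ p q → toℕ p ≤ toℕ q + b
  ρ-descent-short {p} {q} (q<p , p≺q , _) = begin
    toℕ p                    ≡⟨ ≡residue+block*b p ⟩
    residue p + block p * b  ≤⟨ +-mono-≤ (<⇒≤ (residue<b p)) (*-monoˡ-≤ b (Blocks.sorted⇒≤ p≺q)) ⟩
    b + block q * b          ≤⟨ +-monoʳ-≤ b (m≤n+m _ (residue q)) ⟩
    b + (residue q + block q * b) ≡⟨ cong (b +_) (≡residue+block*b q) ⟨
    b + toℕ q                ≡⟨ +-comm b (toℕ q) ⟩
    toℕ q + b                ∎

  -- If `p` exceeded `q + b`, then `q + b`, which has the residue of `q`, would be listed between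
  -- `p` and `q`.
  σ-descent-short : Descent σ p q → toℕ p ≤ toℕ q + b
  σ-descent-short {p} {q} (q<p , p≺q , none) = ≮⇒≥ λ q+b<p →
    between (<-trans q+b<p (Fin.toℕ<n p)) q+b<p
    where
    between : (q+b<n : toℕ q + b < n) → ¬ toℕ q + b < toℕ p
    between q+b<n q+b<p = none q⁺ (p≺q⁺ (Residues.sorted⁻ p≺q) , q⁺≺q)
      where
      q⁺ : Fin n
      q⁺ = fromℕ< q+b<n

      toℕ-q⁺ : toℕ q⁺ ≡ toℕ q + b
      toℕ-q⁺ = Fin.toℕ-fromℕ< q+b<n

      residue-q⁺ : residue q⁺ ≡ residue q
      residue-q⁺ = trans (cong (_% b) toℕ-q⁺) ([m+n]%n≡m%n (toℕ q) b)

      p≺q⁺ : residue p < residue q ⊎ (residue p ≡ residue q × q Fin.< p) → p ≺[ σ ] q⁺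
      p≺q⁺ (inj₁ rp<rq)       = Residues.sorted⁺ (inj₁ (subst (residue p <_) (sym residue-q⁺) rp<rq))
      p≺q⁺ (inj₂ (rp≡rq , _)) =
        Residues.sorted⁺ (inj₂ (trans rp≡rq (sym residue-q⁺) , subst (_< toℕ p) (sym toℕ-q⁺) q+b<p))

      q⁺≺q : q⁺ ≺[ σ ] q
      q⁺≺q = Residues.sorted⁺ (inj₂ (residue-q⁺ , subst (toℕ q <_) (sym toℕ-q⁺) (m<m+n (toℕ q) (>-nonZero⁻¹ b))))

  -- If `ρ` inverts `q < p`, the block of `p` is at most that of `q`. Then `p` has the larger
  -- residue, so `σ` lists `q` first.
  ρ≼rσ : ρ ≼ rev σ
  ρ≼rσ {p} {q} q<p p≺q = rev⁺ (Residues.sorted⁺ (inj₁ (+-cancelʳ-< (block q * b) _ _ (begin-strict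
    residue q + block q * b ≡⟨ ≡residue+block*b q ⟨
    toℕ q                   <⟨ q<p ⟩
    toℕ p                   ≡⟨ ≡residue+block*b p ⟩
    residue p + block p * b ≤⟨ +-monoʳ-≤ (residue p) (*-monoˡ-≤ b (Blocks.sorted⇒≤ p≺q)) ⟩
    residue p + block q * b ∎))))

  -- Above the arc, `rev σ` inverts its ends, so `s` has a smaller residue than `t`. As `t` is at
  -- most `s + b`, both lie in one block, and so do all values between them, which `ρ` lists in
  -- decreasing order.
  rσ⊑ρ : rev σ ⊑ ρ
  rσ⊑ρ S s t short above p q (s≤q , q<p , p≤t , _) =
    Blocks.sorted⁺ ([ inj₁ , inj₂ ∘ (_, q<p) ]′ (m≤n⇒m<n∨m≡n block-p≤block-q))
    where
    s<t : s Fin.< t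
    s<t = ≤-<-trans s≤q (<-≤-trans q<p p≤t)

    residue-s<residue-t : residue s < residue t
    residue-s<residue-t =
      [ id , (λ (_ , t<s) → contradiction t<s (Fin.<-asym s<t)) ]′
        (Residues.sorted⁻ (rev⁻ (above t s (Fin.≤-refl , s<t , Fin.≤-refl , inj₂ refl , inj₂ refl))))

    block-t≤block-s : block t ≤ block s
    block-t≤block-s = ≮⇒≥ λ block-s<block-t → <⇒≱ (begin-strict
      toℕ s + b                     ≡⟨ cong (_+ b) (≡residue+block*b s) ⟩
      residue s + block s * b + b   ≡⟨ +-assoc (residue s) _ b ⟩
      residue s + (block s * b + b) ≡⟨ cong (residue s +_) (+-comm (block s * b) b) ⟩
      residue s + suc (block s) * b <⟨ +-mono-<-≤ residue-s<residue-t (*-monoˡ-≤ b block-s<block-t) ⟩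
      residue t + block t * b       ≡⟨ ≡residue+block*b t ⟨
      toℕ t                         ∎) short

    block-p≤block-q : block p ≤ block q
    block-p≤block-q = ≤-trans (block-mono p≤t) (≤-trans block-t≤block-s (block-mono s≤q))

  hasDegree : ∀ {d} → DegreeAtMost Arcs.congruence ρ d → d + (a + b) ≤ 2 * n →
    HasDegree Arcs.congruence ρ d
  hasDegree {d} bound d+a+b≤2n = LowerBound.hasDegree Arcs.congruence Arcs.∼? {ρ} {σ}
    (Arcs.≼⇒⊑ ρ≼rσ , rσ⊑ρ)
    (λ d → Arcs.lower-⋢ d (ρ-descent-short d) ∘ proj₂)
    (λ d → Arcs.lower-⋢ d (σ-descent-short d) ∘ Arcs.rev-⊑⁻ ∘ proj₁)
    bound
    (+-cancelʳ-≤ (a + b) d _ (begin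
      d + (a + b)                                     ≤⟨ d+a+b≤2n ⟩
      n + (n + 0)                                     ≤⟨ +-mono-≤ (Blocks.n≤keys+tops block<a)
                                                          (+-monoˡ-≤ 0 (Residues.n≤keys+tops residue<b)) ⟩
      (a + length (tops ρ)) + (b + length (tops σ) + 0) ≡⟨ regroup a b (length (tops ρ)) (length (tops σ)) ⟩
      (length (tops ρ) + length (tops σ)) + (a + b)   ∎))
    where
    regroup : ∀ a b s t → (a + s) + (b + t + 0) ≡ (s + t) + (a + b)
    regroup = solve-∀

-- The square of `r` is four times the product of its halves, plus one if `r` is odd. This extra one
-- is too small to reach the next multiple of four.
4n≤r²⇒n≤⌈r/2⌉*⌊r/2⌋ : ∀ n r → 4 * n ≤ r * r → n ≤ ⌈ r /2⌉ * ⌊ r /2⌋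
4n≤r²⇒n≤⌈r/2⌉*⌊r/2⌋ n r 4n≤r² = ≮⇒≥ λ m<n → <⇒≱ (begin-strict
  r * r                                 ≤⟨ r²≤ ⟩
  1 + 4 * (⌈ r /2⌉ * ⌊ r /2⌋)           <⟨ +-monoˡ-< (4 * (⌈ r /2⌉ * ⌊ r /2⌋)) {1} {4} (s≤s (s≤s z≤n)) ⟩
  4 + 4 * (⌈ r /2⌉ * ⌊ r /2⌋)           ≡⟨ *-suc 4 (⌈ r /2⌉ * ⌊ r /2⌋) ⟨
  4 * suc (⌈ r /2⌉ * ⌊ r /2⌋)           ≤⟨ *-monoʳ-≤ 4 m<n ⟩
  4 * n                                 ∎) 4n≤r²
  where
  open ≤-Reasoning

  halves : ∀ r → ⌈ r /2⌉ ≡ ⌊ r /2⌋ ⊎ ⌈ r /2⌉ ≡ suc ⌊ r /2⌋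
  halves 0             = inj₁ refl
  halves 1             = inj₂ refl
  halves (suc (suc r)) = [ inj₁ ∘ cong suc , inj₂ ∘ cong suc ]′ (halves r)

  even : ∀ h → (h + h) * (h + h) ≡ 4 * (h * h)
  even = solve-∀

  odd : ∀ h → (h + suc h) * (h + suc h) ≡ 1 + 4 * (suc h * h)
  odd = solve-∀

  square≤ : ∀ h k → k ≡ h ⊎ k ≡ suc h → (h + k) * (h + k) ≤ 1 + 4 * (k * h)
  square≤ h .h       (inj₁ refl) = ≤-trans (≤-reflexive (even h)) (n≤1+n _)
  square≤ h .(suc h) (inj₂ refl) = ≤-reflexive (odd h)

  r²≤ : r * r ≤ 1 + 4 * (⌈ r /2⌉ * ⌊ r /2⌋)
  r²≤ = subst (λ k → k * k ≤ 1 + 4 * (⌈ r /2⌉ * ⌊ r /2⌋)) (⌊n/2⌋+⌈n/2⌉≡n r)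
    (square≤ ⌊ r /2⌋ ⌈ r /2⌉ (halves r))

mainTheorem15 : (∀ (n : ℕ) → n ≥ 1 → (R : LatticeCongruence n) (X : Permutation′ n) →
    DegreeAtMost R X (2 * n ∸ ⌈2√ n ⌉))
    ×
    (∀ (n : ℕ) → n ≥ 1 →
    Σ[ R ∈ LatticeCongruence n ] Σ[ X ∈ Permutation′ n ]
    HasDegree R X (2 * n ∸ ⌈2√ n ⌉))
mainTheorem15 = (λ n _ R X → UpperBound.degree≤ R X) , attained
  where
  attained : ∀ n → n ≥ 1 → Σ[ R ∈ LatticeCongruence n ] Σ[ X ∈ Permutation′ n ]
    HasDegree R X (2 * n ∸ ⌈2√ n ⌉)
  attained n n≥1 = Arcs.congruence , G.ρ , G.hasDegree (UpperBound.degree≤ Arcs.congruence G.ρ)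
    -- The halves add up to `r`, and `r ≤ 2 * n` makes the truncated subtraction exact.
    (≤-reflexive (trans (cong (2 * n ∸ r +_) (trans (+-comm a b) (⌊n/2⌋+⌈n/2⌉≡n r)))
      (m∸n+n≡m (⌈2√n⌉≤2n n n≥1))))
    where
    r a b : ℕ
    r = ⌈2√ n ⌉
    a = ⌈ r /2⌉
    b = ⌊ r /2⌋

    n≤ab : n ≤ a * b
    n≤ab = 4n≤r²⇒n≤⌈r/2⌉*⌊r/2⌋ n r (⌈√⌉-upper (4 * n))

    b≢0 : NonZero b
    b≢0 = ≢-nonZero λ b≡0 → <⇒≱ n≥1 (subst (n ≤_) (trans (cong (a *_) b≡0) (*-zeroʳ a)) n≤ab)

    module Arcs = ArcCongruence n b
    module G = Grid {n} {a} {b} {{b≢0}} n≤ab
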